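{- For every integer $n\ge0$, $spt_o^{ - }(2n+1)=spt_o^{+}(2n+1)$.
   Context: For a nonempty integer partition $\pi$, let $s(\pi)$ be its smallest part, and call $\pi$ admissible if no odd part of $\pi$ is greater than $2s(\pi)$. $spt_o^{+}(m)$ is the total number of occurrences of the smallest part, summed over all admissible partitions of $m$. For $l\ge1$ let $\delta_l=(l-1,l-2,\dots,1)$, a partition of size $\binom{l}{2}$. $spt_o^{ - }(m)$ is the total number of occurrences of $s(\pi)$ in $\pi$, summed over all pairs $(\pi,\delta_{s(\pi)})$ with $\pi$ admissible and $|\pi|+\binom{s(\pi)}{2}=m$. -}

module Defs where

open import Data.Nat using (ℕ; zero; suc; _+_; _*_; _∸_; _⊓_; _≤ᵇ_; _≡ᵇ_; _%_)
open import Data.Nat.Combinatorics using (_C_)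
open import Data.Bool using (Bool; true; false; _∧_; if_then_else_; not)
open import Data.List using (List; []; _∷_; _++_; map; concatMap; replicate; upTo; foldr; filter; length)
open import Data.Nat.ListAction using (sum)
open import Data.Bool.ListAction using (all)

-- A partition is represented as a (weakly) decreasing list of positive parts.
-- ptns n k : all partitions of n whose parts are all ≤ k (each listed exactly once).
-- For parts ≤ suc k: choose the multiplicity j of the part (suc k), then a
-- partition of the rest with parts ≤ k.
ptns : ℕ → ℕ → List (List ℕ)
ptns zero    zero    = [] ∷ []
ptns (suc n) zero    = []
ptns n       (suc k) =
  concatMap (λ j → map (replicate j (suc k) ++_) (ptns (n ∸ j * suc k) k))
            (filter (λ j → j * suc k Data.Nat.≤? n) (upTo (suc n)))

partitions : ℕ → List (List ℕ)
partitions n = ptns n n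

-- smallest part s(π) (only meaningful for nonempty π)
smallest : List ℕ → ℕ
smallest []       = 0
smallest (x ∷ xs) = foldr _⊓_ x xs

isOdd : ℕ → Bool
isOdd n = n % 2 ≡ᵇ 1

nonempty : List ℕ → Bool
nonempty []      = false
nonempty (_ ∷ _) = true

admissible : List ℕ → Bool
admissible π = nonempty π ∧ all (λ p → not (isOdd p) Data.Bool.∨ (p ≤ᵇ 2 * smallest π)) π

occ : List ℕ → ℕ
occ π = length (filter (λ p → p Data.Nat.≟ smallest π) π)

sptoPlus : ℕ → ℕ
sptoPlus m = sum (map (λ π → if admissible π then occ π else 0) (partitions m))

-- spt_o^-(m): sum over admissible π with |π| + binom(s(π),2) = m of the
-- multiplicity of s(π); here |π| = k ranges over 0..m (since binom(s,2) ≥ 0).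
sptoMinus : ℕ → ℕ
sptoMinus m = sum (map (λ k →
  sum (map (λ π → if admissible π ∧ (k + (smallest π C 2) ≡ᵇ m) then occ π else 0)
           (partitions k)))
  (upTo (suc m)))

{-# OPTIONS --safe #-}

-- For fixed smallest part s the admissible partitions contribute
-- q^s / ((1-q^s)² (q^{s+1};q)_s (q^{2s+2};q²)_∞) = q^s (q)_{s-1}² β_s / (q²;q²)_∞ with
-- β_s = 1/((q)_s (q;q²)_s), and spt_o^- replaces β_s by q^{s(s-1)/2} β_s. Both sequences occur in
-- Bailey pairs relative to 1 (Slater's C(1) and C(5)) with α_0 = 1, α_r = 0 for odd r and α_r
-- even in q. Since ∑_s (q)_{s-1}² q^s β_s = ∑_{r>0} α_r q^r/(1-q^r)² + α_0 ∑_s q^s/(1-q^s)²,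
-- the two generating functions differ by an even function of q. To have finite sums only,
-- everything is done up to a partial sum s ≤ K, at the cost of an error divisible by q^{K+1}.
module Submission where

open import Defs
open import Algebra.Bundles using (CommutativeRing; RawRing)
open import Data.Bool using (Bool; true; false; not; _∧_; _∨_; if_then_else_)
open import Data.Bool.ListAction using (all)
open import Data.Bool.Properties using (not-injective; not-involutive; ∨-zeroʳ; ∧-zeroʳ; ∧-identityʳ)
open import Data.List
  using (List; []; _∷_; _++_; map; concatMap; replicate; upTo; applyUpTo; foldr; filter; length)
open import Data.List.Membership.Propositional using (_∈_)
open import Data.List.Properties
  using ( map-cong; map-cong-local; map-∘; map-++; map-upTo; upTo-∷ʳ; filter-++; filter-accept
        ; filter-reject; filter-none; ++-identityʳ)
open import Data.List.Relation.Unary.All as All using (All; []; _∷_)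
import Data.List.Relation.Unary.All.Properties as All
open import Data.List.Relation.Unary.Any using (here; there)
open import Data.Maybe.Base using (just; nothing)
open import Data.Nat as ℕ using (ℕ; zero; suc; z≤n; s≤s; _≤?_; _≟_; _≤ᵇ_; _≡ᵇ_; _⊓_)
open import Data.Nat.Combinatorics using (_C_; nC1≡n; nCk+nC[k+1]≡[n+1]C[k+1])
open import Data.Nat.ListAction using (sum)
open import Data.Nat.ListAction.Properties using (sum-++)
import Data.Nat.Properties as ℕ
open import Data.Product using (_×_; _,_; ∃-syntax; swap; proj₁; proj₂)
open import Data.Sum using (inj₁; inj₂)
open import Level using (0ℓ)
open import Relation.Binary.Definitions using (tri<; tri≈; tri>)
open import Relation.Binary.PropositionalEquality as ≡ using (_≡_; _≢_)
open import Relation.Nullary using (Dec; yes; no; contradiction)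
open import Relation.Nullary.Decidable using (dec-true; dec-false)

-- The contribution of α_0 is not even in q, but α_0 = 1 in both pairs. So neither generating
-- function is evaluated on its own: only their difference is, and there this term cancels. For each
-- r the sum over s up to n has an exact closed form, `term`, verified by its increment in n. It
-- differs from its limit by the factor (q)_n²/((q)_{n-2r}(q)_{n+2r}), which is 1 modulo q^{n-2r+1}.
-- The two Bailey pairs are likewise verified by first-order recurrences in n, whose sums over r
-- telescope.
--
-- The obstacle is division: exponents such as n-2r may be negative, and only inverses of 1-q^k with
-- k > 0 are given. Relations between neighbouring q-factorials are therefore multiplied by a power
-- of q, and each recurrence is checked as a polynomial identity modulo such relations. All this
-- makes sense in any commutative ring; evenness in q does not, and enters only with power series.

-- Ring solver with integer coefficients

module DifferenceCoefficients {c ℓ} (R : CommutativeRing c ℓ) where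
  open CommutativeRing R
  open import Algebra.Properties.Ring ring
  open import Algebra.Properties.Semiring.Mult semiring
    using (×-homo-+; ×1-homo-*; ×-congˡ) renaming (_×_ to _·_)
  open import Algebra.Properties.CommutativeSemigroup +-commutativeSemigroup
    using (interchange)
  open import Algebra.Solver.Ring.AlmostCommutativeRing
    using (fromCommutativeRing; _-Raw-AlmostCommutative⟶_; Induced-equivalence)
  open import Relation.Binary.Reasoning.Setoid setoid
  open import Relation.Binary.Definitions using (WeaklyDecidable)

  -- Pairs (a , b) stand for a - b. They are kept reduced, since the solver compares
  -- normal forms syntactically.
  reduce : ℕ × ℕ → ℕ × ℕ
  reduce (a , b) = a ℕ.∸ b , b ℕ.∸ a

  _⊕_ _⊛_ : ℕ × ℕ → ℕ × ℕ → ℕ × ℕ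
  (a , b) ⊕ (c , d) = a ℕ.+ c , b ℕ.+ d
  (a , b) ⊛ (c , d) = a ℕ.* c ℕ.+ b ℕ.* d , a ℕ.* d ℕ.+ b ℕ.* c

  -- An arbitrary ring has no decidable equality, so the solver calculates with these integers and
  -- maps them into the ring; otherwise like terms would not cancel.
  differences : RawRing 0ℓ 0ℓ
  differences = record
    { Carrier = ℕ × ℕ
    ; _≈_     = _≡_
    ; _+_     = λ x y → reduce (x ⊕ y)
    ; _*_     = λ x y → reduce (x ⊛ y)
    ; -_      = swap
    ; 0#      = 0 , 0
    ; 1#      = 1 , 0
    }

  ⟦_⟧ : ℕ × ℕ → Carrier
  ⟦ a , b ⟧ = a · 1# - b · 1#

  +-[-] : ∀ x y u v → (x - y) + (u - v) ≈ (x + u) - (y + v)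
  +-[-] x y u v = trans (interchange x (- y) u (- v)) (+-congˡ (-‿+-comm y v))

  -[-] : ∀ x y u v → (x - y) - (u - v) ≈ (x + v) - (y + u)
  -[-] x y u v = trans (+-congˡ (⁻¹-anti-homo‿- u v)) (+-[-] x y v u)

  homo-+ : ∀ m n → (m ℕ.+ n) · 1# ≈ m · 1# + n · 1#
  homo-+ = ×-homo-+ 1#

  homo-** : ∀ a b c d → (a ℕ.* b ℕ.+ c ℕ.* d) · 1# ≈ a · 1# * b · 1# + c · 1# * d · 1#
  homo-** a b c d = trans (homo-+ (a ℕ.* b) (c ℕ.* d)) (+-cong (×1-homo-* a b) (×1-homo-* c d))

  -- Unlike ⟦_⟧, this sends the constants 0 and 1 to 0# and 1# definitionally, so that con can
  -- be matched against goals containing 0# and 1#.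
  ⟦_⟧ₙ : ℕ × ℕ → Carrier
  ⟦ zero , zero ⟧ₙ     = 0#
  ⟦ suc zero , zero ⟧ₙ = 1#
  ⟦ a , b ⟧ₙ           = ⟦ a , b ⟧

  ⟦⟧ₙ≈⟦⟧ : ∀ x → ⟦ x ⟧ₙ ≈ ⟦ x ⟧
  ⟦⟧ₙ≈⟦⟧ (zero , zero)        = sym (-‿inverseʳ 0#)
  ⟦⟧ₙ≈⟦⟧ (zero , suc b)       = refl
  ⟦⟧ₙ≈⟦⟧ (suc zero , zero)    =
    sym (trans (+-cong (+-identityʳ 1#) -0#≈0#) (+-identityʳ 1#))
  ⟦⟧ₙ≈⟦⟧ (suc zero , suc b)   = refl
  ⟦⟧ₙ≈⟦⟧ (suc (suc a) , b)    = refl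

  ⟦⟧-+ : ∀ x y → ⟦ x ⊕ y ⟧ ≈ ⟦ x ⟧ + ⟦ y ⟧
  ⟦⟧-+ (a , b) (c , d) =
    trans (+-cong (homo-+ a c) (-‿cong (homo-+ b d))) (sym (+-[-] _ _ _ _))

  ⟦⟧-* : ∀ x y → ⟦ x ⊛ y ⟧ ≈ ⟦ x ⟧ * ⟦ y ⟧
  ⟦⟧-* (a , b) (c , d) = begin
    (a ℕ.* c ℕ.+ b ℕ.* d) · 1# - (a ℕ.* d ℕ.+ b ℕ.* c) · 1#
      ≈⟨ +-cong (homo-** a c b d) (-‿cong (homo-** a d b c)) ⟩
    (a · 1# * c · 1# + b · 1# * d · 1#) - (a · 1# * d · 1# + b · 1# * c · 1#)
      ≈⟨ -[-] _ _ _ _ ⟨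
    (a · 1# * c · 1# - a · 1# * d · 1#) - (b · 1# * c · 1# - b · 1# * d · 1#)
      ≈⟨ +-cong (x[y-z]≈xy-xz _ _ _) (-‿cong (x[y-z]≈xy-xz _ _ _)) ⟨
    a · 1# * (c · 1# - d · 1#) - b · 1# * (c · 1# - d · 1#)
      ≈⟨ [y-z]x≈yx-zx _ _ _ ⟨
    (a · 1# - b · 1#) * (c · 1# - d · 1#) ∎

  ⟦⟧-reduce : ∀ x → ⟦ reduce x ⟧ ≈ ⟦ x ⟧
  ⟦⟧-reduce (zero  , zero)  = refl
  ⟦⟧-reduce (zero  , suc b) = refl
  ⟦⟧-reduce (suc a , zero)  = refl
  ⟦⟧-reduce (suc a , suc b) = begin
    ⟦ reduce (a , b) ⟧                  ≈⟨ ⟦⟧-reduce (a , b) ⟩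
    a · 1# - b · 1#                     ≈⟨ +-identityˡ _ ⟨
    0# + (a · 1# - b · 1#)              ≈⟨ +-congʳ (-‿inverseʳ 1#) ⟨
    (1# - 1#) + (a · 1# - b · 1#)       ≈⟨ +-[-] _ _ _ _ ⟩
    (1# + a · 1#) - (1# + b · 1#)       ∎

  morphism : differences -Raw-AlmostCommutative⟶ fromCommutativeRing R
  morphism = record
    { ⟦_⟧    = ⟦_⟧ₙ
    ; +-homo = λ x y → trans (⟦⟧ₙ≈⟦⟧ (reduce (x ⊕ y)))
        (trans (trans (⟦⟧-reduce (x ⊕ y)) (⟦⟧-+ x y)) (sym (+-cong (⟦⟧ₙ≈⟦⟧ x) (⟦⟧ₙ≈⟦⟧ y))))
    ; *-homo = λ x y → trans (⟦⟧ₙ≈⟦⟧ (reduce (x ⊛ y)))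
        (trans (trans (⟦⟧-reduce (x ⊛ y)) (⟦⟧-* x y)) (sym (*-cong (⟦⟧ₙ≈⟦⟧ x) (⟦⟧ₙ≈⟦⟧ y))))
    ; -‿homo = λ x → trans (⟦⟧ₙ≈⟦⟧ (swap x))
        (trans (sym (⁻¹-anti-homo‿- _ _)) (sym (-‿cong (⟦⟧ₙ≈⟦⟧ x))))
    ; 0-homo = refl
    ; 1-homo = refl
    }

  _≟ᶜ_ : WeaklyDecidable (Induced-equivalence morphism)
  x@(a , b) ≟ᶜ y@(c , d) with a ℕ.+ d ℕ.≟ c ℕ.+ b
  ... | no _  = nothing
  ... | yes e = just (trans (⟦⟧ₙ≈⟦⟧ x) (trans (x∙y⁻¹≈ε⇒x≈y _ _ (begin
    (a · 1# - b · 1#) - (c · 1# - d · 1#) ≈⟨ -[-] _ _ _ _ ⟩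
    (a · 1# + d · 1#) - (b · 1# + c · 1#) ≈⟨ +-congˡ (-‿cong (+-comm _ _)) ⟩
    (a · 1# + d · 1#) - (c · 1# + b · 1#) ≈⟨ +-cong (homo-+ a d) (-‿cong (homo-+ c b)) ⟨
    (a ℕ.+ d) · 1# - (c ℕ.+ b) · 1#       ≈⟨ +-congʳ (×-congˡ e) ⟩
    (c ℕ.+ b) · 1# - (c ℕ.+ b) · 1#       ≈⟨ -‿inverseʳ _ ⟩
    0# ∎)) (sym (⟦⟧ₙ≈⟦⟧ y))))

  open import Algebra.Solver.Ring differences (fromCommutativeRing R) morphism _≟ᶜ_ public
    using (Polynomial; solve; _:=_; _:+_; _:*_; _:-_; :-_; con)

-- q-factorials and their inverses

OneMinusPowerInverses : ∀ {c ℓ} (R : CommutativeRing c ℓ) (q : CommutativeRing.Carrier R) →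
  (ℕ → CommutativeRing.Carrier R) → Set ℓ
OneMinusPowerInverses R q inv = ∀ k → (1# - q ^ suc k) * inv k ≈ 1#
  where
    open CommutativeRing R
    open import Algebra.Properties.Semiring.Exp semiring using (_^_)

module BaileyPairs {c ℓ} (R : CommutativeRing c ℓ) (q : CommutativeRing.Carrier R)
  (inv : ℕ → CommutativeRing.Carrier R) (inv-law : OneMinusPowerInverses R q inv) where

  open CommutativeRing R hiding (zero)
  open import Algebra.Properties.Semiring.Exp semiring using (_^_; ^-homo-*; ^-congʳ)
  open import Algebra.Properties.Ring ring
  open import Relation.Binary.Reasoning.Setoid setoid
  open DifferenceCoefficients R using (Polynomial; solve; _:=_; _:+_; _:*_; _:-_; :-_; con)

  private
    :1 : ∀ {n} → Polynomial n
    :1 = con (1 , 0)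

  -- This lets the solver work modulo known relations: `s ≈ t` is a combination of them, and
  -- `u + s ≈ v + t` is then a polynomial identity.
  cancel : ∀ {u v s t} → u + s ≈ v + t → s ≈ t → u ≈ v
  cancel {u} {v} {s} {t} e h = +-cancelʳ t u v (trans (+-congˡ (sym h)) e)

  Σ : (ℕ → Carrier) → ℕ → Carrier
  Σ f zero    = 0#
  Σ f (suc n) = Σ f n + f n

  Σ-cong : ∀ {f g} n → (∀ i → i ℕ.< n → f i ≈ g i) → Σ f n ≈ Σ g n
  Σ-cong zero    h = refl
  Σ-cong (suc n) h = +-cong (Σ-cong n (λ i i<n → h i (ℕ.m<n⇒m<1+n i<n))) (h n ℕ.≤-refl)

  Σ-0 : ∀ {f} n → (∀ i → f i ≈ 0#) → Σ f n ≈ 0#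
  Σ-0 zero    h = refl
  Σ-0 (suc n) h = trans (+-cong (Σ-0 n h) (h n)) (+-identityʳ 0#)

  Σ-+ : ∀ f g n → Σ (λ i → f i + g i) n ≈ Σ f n + Σ g n
  Σ-+ f g zero    = sym (+-identityʳ 0#)
  Σ-+ f g (suc n) = trans (+-congʳ (Σ-+ f g n))
    (solve 4 (λ a b c d → (a :+ b) :+ (c :+ d) := (a :+ c) :+ (b :+ d)) refl (Σ f n) (Σ g n) (f n) (g n))

  Σ-*ˡ : ∀ x f n → Σ (λ i → x * f i) n ≈ x * Σ f n
  Σ-*ˡ x f zero    = sym (zeroʳ x)
  Σ-*ˡ x f (suc n) = trans (+-congʳ (Σ-*ˡ x f n)) (sym (distribˡ x _ _))

  -- Doubling by constructors, so that `poch⁻¹∸` and powers compute on `dbl (suc r)`.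
  dbl : ℕ → ℕ
  dbl zero    = zero
  dbl (suc n) = suc (suc (dbl n))

  poch : ℕ → Carrier
  poch zero    = 1#
  poch (suc n) = (1# - q ^ suc n) * poch n

  poch⁻¹ : ℕ → Carrier
  poch⁻¹ zero    = 1#
  poch⁻¹ (suc n) = inv n * poch⁻¹ n

  oddPoch⁻¹ : ℕ → Carrier
  oddPoch⁻¹ zero    = 1#
  oddPoch⁻¹ (suc n) = inv (n ℕ.+ n) * oddPoch⁻¹ n

  inv-cancel : ∀ k x → (1# - q ^ suc k) * (inv k * x) ≈ x
  inv-cancel k x = begin
    (1# - q ^ suc k) * (inv k * x) ≈⟨ *-assoc _ _ _ ⟨
    (1# - q ^ suc k) * inv k * x   ≈⟨ *-congʳ (inv-law k) ⟩
    1# * x                         ≈⟨ *-identityˡ x ⟩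
    x ∎

  -- The power is kept as a product of two, since the solver treats both factors as variables.
  poch⁻¹-step : ∀ n m → (1# - q ^ n * q ^ suc m) * poch⁻¹ (n ℕ.+ suc m) ≈ poch⁻¹ (n ℕ.+ m)
  poch⁻¹-step n m = begin
    (1# - q ^ n * q ^ suc m) * poch⁻¹ (n ℕ.+ suc m)
      ≡⟨ ≡.cong (λ k → (1# - q ^ n * q ^ suc m) * poch⁻¹ k) (ℕ.+-suc n m) ⟩
    (1# - q ^ n * q ^ suc m) * poch⁻¹ (suc (n ℕ.+ m))
      ≈⟨ *-congʳ (+-congˡ (-‿cong (trans (sym (^-homo-* q n (suc m))) (^-congʳ q (ℕ.+-suc n m))))) ⟩
    (1# - q ^ suc (n ℕ.+ m)) * poch⁻¹ (suc (n ℕ.+ m))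
      ≈⟨ inv-cancel (n ℕ.+ m) _ ⟩
    poch⁻¹ (n ℕ.+ m) ∎

  -- 1/(q)_{n-m}, which is 0 when n < m.
  poch⁻¹∸ : ℕ → ℕ → Carrier
  poch⁻¹∸ n       zero    = poch⁻¹ n
  poch⁻¹∸ zero    (suc m) = 0#
  poch⁻¹∸ (suc n) (suc m) = poch⁻¹∸ n m

  poch⁻¹∸-< : ∀ {n m} → n ℕ.< m → poch⁻¹∸ n m ≈ 0#
  poch⁻¹∸-< {zero}  {suc m} _         = refl
  poch⁻¹∸-< {suc n} {suc m} (s≤s n<m) = poch⁻¹∸-< n<m

  poch⁻¹∸-+ : ∀ m k → poch⁻¹∸ (m ℕ.+ k) m ≡ poch⁻¹ k
  poch⁻¹∸-+ zero    k = ≡.refl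
  poch⁻¹∸-+ (suc m) k = poch⁻¹∸-+ m k

  -- The relation 1/(q)_{k-1} = (1 - q^k)/(q)_k for k = n - m, multiplied by q^j so that
  -- it also makes sense (and holds) for negative k.
  poch⁻¹∸-step : ∀ n m j i → j ℕ.+ n ≡ m ℕ.+ i →
    q ^ j * poch⁻¹∸ n (suc m) ≈ (q ^ j - q ^ i) * poch⁻¹∸ n m
  poch⁻¹∸-step zero    zero    j i e = begin
    q ^ j * 0#         ≈⟨ zeroʳ _ ⟩
    0#                 ≈⟨ zeroˡ _ ⟨
    0# * 1#            ≈⟨ *-congʳ (-‿inverseʳ (q ^ j)) ⟨
    (q ^ j - q ^ j) * 1# ≈⟨ *-congʳ (+-congˡ (-‿cong (^-congʳ q (≡.trans (≡.sym (ℕ.+-identityʳ j)) e)))) ⟩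
    (q ^ j - q ^ i) * 1# ∎
  poch⁻¹∸-step (suc n) zero    j i e = begin
    q ^ j * poch⁻¹ n
      ≈⟨ *-congˡ (inv-cancel n (poch⁻¹ n)) ⟨
    q ^ j * ((1# - q ^ suc n) * poch⁻¹ (suc n))
      ≈⟨ solve 3 (λ x y z → x :* ((:1 :- y) :* z) := (x :- x :* y) :* z) refl (q ^ j) (q ^ suc n) (poch⁻¹ (suc n)) ⟩
    (q ^ j - q ^ j * q ^ suc n) * poch⁻¹ (suc n)
      ≈⟨ *-congʳ (+-congˡ (-‿cong (trans (sym (^-homo-* q j (suc n))) (^-congʳ q e)))) ⟩
    (q ^ j - q ^ i) * poch⁻¹ (suc n) ∎
  poch⁻¹∸-step zero    (suc m) j i e = trans (zeroʳ _) (sym (zeroʳ _))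
  poch⁻¹∸-step (suc n) (suc m) j i e =
    poch⁻¹∸-step n m j i (ℕ.suc-injective (≡.trans (≡.sym (ℕ.+-suc j n)) e))

  -- The Bailey pairs C(1) and C(5)

  -- The coefficient of α_{2r} in β_n = ∑ α_r / ((q)_{n-r} (q)_{n+r})
  T : ℕ → ℕ → Carrier
  T n r = poch⁻¹∸ n (dbl r) * poch⁻¹ (dbl r ℕ.+ n)

  -- Slater's Bailey pairs C(1) and C(5) relative to 1 have α_{2r} = a r * (1 + q^{2r}) for
  -- r > 0 with a r = (-1)^r q^{3r²-r} and a r = (-1)^r q^{r²-r} respectively, and α_r = 0
  -- for odd r.
  a₁ a₅ : ℕ → Carrier
  a₁ zero    = 1#
  a₁ (suc r) = - (q ^ dbl r * q ^ dbl r * q ^ dbl (suc r)) * a₁ r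
  a₅ zero    = 1#
  a₅ (suc r) = - (q ^ dbl r) * a₅ r

  -- The Bailey sum cut off after index R. The omitted terms vanish when n < 2R + 2, because they
  -- contain 1/(q)_{n-2r} with 2r > n.
  bailey : (ℕ → Carrier) → ℕ → ℕ → Carrier
  bailey a n = λ R → T n 0 + Σ (λ r → a (suc r) * (1# + q ^ dbl (suc r)) * T n (suc r)) R

  -- Every q-factorial in the recurrences at n and r is tied by these relations to `x`, `x₁`, `x₂`
  -- and `y`, with coefficients polynomial in `z`, `M` and `p`. The polynomial identities treat `M`
  -- and `p` as independent variables.
  module Step (n r : ℕ) where
    z M p x x₁ x₂ y : Carrier
    z  = q ^ dbl (suc r)
    M  = q ^ suc n
    p  = q ^ n
    x  = poch⁻¹∸ (suc n) (dbl (suc r))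
    x₁ = poch⁻¹∸ n (dbl (suc r))
    x₂ = poch⁻¹∸ (suc n) (dbl (suc (suc r)))
    y  = poch⁻¹ (dbl (suc r) ℕ.+ suc n)

    x₁-rel : z * x₁ ≈ (z - M) * x
    x₁-rel = poch⁻¹∸-step (suc n) (dbl (suc r)) (dbl (suc r)) (suc n) ≡.refl

    x₂-rel : z * x₂ ≈ (z - p) * x₁
    x₂-rel = poch⁻¹∸-step (suc n) (suc (dbl (suc r))) (dbl (suc r)) n (ℕ.+-suc (dbl (suc r)) n)

    y₁-rel : poch⁻¹ (dbl (suc r) ℕ.+ n) ≈ (1# - z * M) * y
    y₁-rel = sym (poch⁻¹-step (dbl (suc r)) n)

    y₂-rel : poch⁻¹ (dbl r ℕ.+ suc n) ≈ (1# - z * p) * ((1# - z * M) * y)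
    y₂-rel = begin
      poch⁻¹ (dbl r ℕ.+ suc n)
        ≡⟨ ≡.cong poch⁻¹ (ℕ.+-suc (dbl r) n) ⟩
      poch⁻¹ (suc (dbl r ℕ.+ n))
        ≈⟨ inv-cancel _ _ ⟨
      (1# - q ^ (dbl (suc r) ℕ.+ n)) * poch⁻¹ (dbl (suc r) ℕ.+ n)
        ≈⟨ *-cong (+-congˡ (-‿cong (^-homo-* q (dbl (suc r)) n))) y₁-rel ⟩
      (1# - z * p) * ((1# - z * M) * y) ∎

  -- The boundary terms left by the telescoping summation over r in the recurrences below.
  g₁ g₅ : ℕ → ℕ → Carrier
  g₁ n r = a₁ r * (q ^ dbl r * q ^ dbl r) * q ^ suc n
             * (poch⁻¹∸ (suc n) (dbl (suc r)) * poch⁻¹ (dbl r ℕ.+ suc n))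
  g₅ n r = a₅ r * q ^ dbl r * (poch⁻¹∸ (suc n) (dbl (suc r)) * poch⁻¹ (dbl r ℕ.+ suc n))

  poch⁻¹∸-1 : ∀ n → poch⁻¹∸ n 1 ≈ (1# - q ^ n) * poch⁻¹ n
  poch⁻¹∸-1 n = trans (sym (*-identityˡ _)) (poch⁻¹∸-step n 0 0 n ≡.refl)

  -- In the inductive step, U and V are the multiples of x₁-rel and x₂-rel modulo which the
  -- claim becomes a polynomial identity.
  bailey₁-step : ∀ n R →
    (1# - q ^ suc n) * (1# - q ^ n * q ^ suc n) * bailey a₁ (suc n) R ≈ bailey a₁ n R + g₁ n R
  bailey₁-step n zero = begin
    (1# - M) * (1# - p * M) * (y * y + 0#)
      -- Uses 1 - pM = (1 - M) + M(1 - p); the second summand becomes `g₁ n 0`.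
      ≈⟨ solve 3 (λ M p y → (:1 :- M) :* (:1 :- p :* M) :* (y :* y :+ con (0 , 0))
            := ((:1 :- M) :* y) :* ((:1 :- M) :* y)
               :+ M :* (((:1 :- p) :* ((:1 :- M) :* y)) :* y)) refl M p y ⟩
    ((1# - M) * y) * ((1# - M) * y) + M * (((1# - p) * ((1# - M) * y)) * y)
      ≈⟨ +-cong (*-cong (inv-cancel n _) (inv-cancel n _)) (*-congˡ (*-congʳ (*-congˡ (inv-cancel n _)))) ⟩
    poch⁻¹ n * poch⁻¹ n + M * (((1# - p) * poch⁻¹ n) * y)
      ≈⟨ +-congˡ (*-congˡ (*-congʳ (poch⁻¹∸-1 n))) ⟨
    poch⁻¹ n * poch⁻¹ n + M * (poch⁻¹∸ n 1 * y)
      ≈⟨ solve 3 (λ a M b → a :+ M :* b := (a :+ con (0 , 0)) :+ :1 :* (:1 :* :1) :* M :* b) refl (poch⁻¹ n * poch⁻¹ n) M (poch⁻¹∸ n 1 * y) ⟩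
    (poch⁻¹ n * poch⁻¹ n + 0#) + 1# * (1# * 1#) * M * (poch⁻¹∸ n 1 * y) ∎
    where
      M = q ^ suc n
      p = q ^ n
      y = poch⁻¹ (suc n)
  bailey₁-step n (suc r) = begin
    (1# - M) * (1# - p * M) * bailey a₁ (suc n) (suc r)
      ≈⟨ solve 4 (λ u s t v → u :* (s :+ (t :+ v)) := u :* (s :+ t) :+ u :* v) refl
            ((1# - M) * (1# - p * M)) (T (suc n) 0)
            (Σ (λ i → a₁ (suc i) * (1# + q ^ dbl (suc i)) * T (suc n) (suc i)) r)
            (- (b * z) * a * (1# + z) * (x * y)) ⟩
    (1# - M) * (1# - p * M) * bailey a₁ (suc n) r + (1# - M) * (1# - p * M) * (- (b * z) * a * (1# + z) * (x * y))
      ≈⟨ +-cong (bailey₁-step n r) step ⟩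
    (bailey a₁ n r + g₁ n r) + (- (b * z) * a * (1# + z) * (x₁ * ((1# - z * M) * y))
      + - (b * z) * a * (z * z) * M * (x₂ * y)
      - a * b * M * (x * ((1# - z * p) * ((1# - z * M) * y))))
      ≈⟨ +-congˡ (+-cong (+-congʳ (*-congˡ (*-congˡ y₁-rel))) (-‿cong (*-congˡ (*-congˡ y₂-rel)))) ⟨
    (bailey a₁ n r + g₁ n r) + (- (b * z) * a * (1# + z) * T n (suc r) + g₁ n (suc r) - g₁ n r)
      ≈⟨ solve 5 (λ s t g u v → ((s :+ t) :+ g) :+ (u :+ v :- g) := (s :+ (t :+ u)) :+ v) refl
            (T n 0) (Σ (λ i → a₁ (suc i) * (1# + q ^ dbl (suc i)) * T n (suc i)) r) (g₁ n r)
            (- (b * z) * a * (1# + z) * T n (suc r)) (g₁ n (suc r)) ⟩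
    bailey a₁ n (suc r) + g₁ n (suc r) ∎
    where
      open Step n r
      a = a₁ r
      b = q ^ dbl r * q ^ dbl r
      U = - (a * b * y * ((1# + z) * (1# - z * M) + z * M * (z - p)))
      V = - (a * b * y * (z * z * M))
      step : (1# - M) * (1# - p * M) * (- (b * z) * a * (1# + z) * (x * y))
        ≈ - (b * z) * a * (1# + z) * (x₁ * ((1# - z * M) * y))
          + - (b * z) * a * (z * z) * M * (x₂ * y)
          - a * b * M * (x * ((1# - z * p) * ((1# - z * M) * y)))
      step = cancel
        (solve 9 (λ z M p a b x x₁ x₂ y →
          let U = :- (a :* b :* y :* ((:1 :+ z) :* (:1 :- z :* M) :+ z :* M :* (z :- p)))
              V = :- (a :* b :* y :* (z :* z :* M)) in
          (:1 :- M) :* (:1 :- p :* M) :* (:- (b :* z) :* a :* (:1 :+ z) :* (x :* y))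
            :+ (U :* (z :* x₁) :+ V :* (z :* x₂))
          := (:- (b :* z) :* a :* (:1 :+ z) :* (x₁ :* ((:1 :- z :* M) :* y))
            :+ :- (b :* z) :* a :* (z :* z) :* M :* (x₂ :* y)
            :- a :* b :* M :* (x :* ((:1 :- z :* p) :* ((:1 :- z :* M) :* y))))
            :+ (U :* ((z :- M) :* x) :+ V :* ((z :- p) :* x₁)))
          refl z M p a b x x₁ x₂ y)
        (+-cong (*-congˡ {U} x₁-rel) (*-congˡ {V} x₂-rel))

  -- The factor `q ^ n`, absent for the first pair, is the ratio of consecutive values of `qC2`; its
  -- accumulation is the only difference between the two β sequences.
  bailey₅-step : ∀ n R →
    (1# - q ^ suc n) * (1# - q ^ n * q ^ suc n) * bailey a₅ (suc n) R ≈ q ^ n * bailey a₅ n R + g₅ n R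
  bailey₅-step n zero = begin
    (1# - M) * (1# - p * M) * (y * y + 0#)
      -- Here the splitting is 1 - pM = p(1 - M) + (1 - p).
      ≈⟨ solve 3 (λ M p y → (:1 :- M) :* (:1 :- p :* M) :* (y :* y :+ con (0 , 0))
            := p :* (((:1 :- M) :* y) :* ((:1 :- M) :* y))
               :+ ((:1 :- p) :* ((:1 :- M) :* y)) :* y) refl M p y ⟩
    p * (((1# - M) * y) * ((1# - M) * y)) + ((1# - p) * ((1# - M) * y)) * y
      ≈⟨ +-cong (*-congˡ (*-cong (inv-cancel n _) (inv-cancel n _))) (*-congʳ (*-congˡ (inv-cancel n _))) ⟩
    p * (poch⁻¹ n * poch⁻¹ n) + ((1# - p) * poch⁻¹ n) * y
      ≈⟨ +-congˡ (*-congʳ (poch⁻¹∸-1 n)) ⟨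
    p * (poch⁻¹ n * poch⁻¹ n) + poch⁻¹∸ n 1 * y
      ≈⟨ solve 3 (λ a p b → p :* a :+ b := p :* (a :+ con (0 , 0)) :+ :1 :* :1 :* b) refl
            (poch⁻¹ n * poch⁻¹ n) p (poch⁻¹∸ n 1 * y) ⟩
    p * (poch⁻¹ n * poch⁻¹ n + 0#) + 1# * 1# * (poch⁻¹∸ n 1 * y) ∎
    where
      M = q ^ suc n
      p = q ^ n
      y = poch⁻¹ (suc n)
  bailey₅-step n (suc r) = begin
    (1# - M) * (1# - p * M) * bailey a₅ (suc n) (suc r)
      ≈⟨ solve 4 (λ u s t v → u :* (s :+ (t :+ v)) := u :* (s :+ t) :+ u :* v) refl
            ((1# - M) * (1# - p * M)) (T (suc n) 0)
            (Σ (λ i → a₅ (suc i) * (1# + q ^ dbl (suc i)) * T (suc n) (suc i)) r)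
            (- e * a * (1# + z) * (x * y)) ⟩
    (1# - M) * (1# - p * M) * bailey a₅ (suc n) r + (1# - M) * (1# - p * M) * (- e * a * (1# + z) * (x * y))
      ≈⟨ +-cong (bailey₅-step n r) step ⟩
    (p * bailey a₅ n r + g₅ n r) + (p * (- e * a * (1# + z) * (x₁ * ((1# - z * M) * y)))
      + - e * a * z * (x₂ * y)
      - a * e * (x * ((1# - z * p) * ((1# - z * M) * y))))
      ≈⟨ +-congˡ (+-cong (+-congʳ (*-congˡ (*-congˡ (*-congˡ y₁-rel)))) (-‿cong (*-congˡ (*-congˡ y₂-rel)))) ⟨
    (p * bailey a₅ n r + g₅ n r) + (p * (- e * a * (1# + z) * T n (suc r)) + g₅ n (suc r) - g₅ n r)
      ≈⟨ solve 6 (λ p s t g u v → (p :* (s :+ t) :+ g) :+ (p :* u :+ v :- g) := p :* (s :+ (t :+ u)) :+ v) refl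
            p (T n 0) (Σ (λ i → a₅ (suc i) * (1# + q ^ dbl (suc i)) * T n (suc i)) r) (g₅ n r)
            (- e * a * (1# + z) * T n (suc r)) (g₅ n (suc r)) ⟩
    p * bailey a₅ n (suc r) + g₅ n (suc r) ∎
    where
      open Step n r
      a = a₅ r
      e = q ^ dbl r
      U = - (a * e * y * (p * (1# - M - z * M) + 1#))
      V = - (a * e * y)
      step : (1# - M) * (1# - p * M) * (- e * a * (1# + z) * (x * y))
        ≈ p * (- e * a * (1# + z) * (x₁ * ((1# - z * M) * y)))
          + - e * a * z * (x₂ * y)
          - a * e * (x * ((1# - z * p) * ((1# - z * M) * y)))
      step = cancel
        (solve 9 (λ z M p a e x x₁ x₂ y →
          let U = :- (a :* e :* y :* (p :* (:1 :- M :- z :* M) :+ :1))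
              V = :- (a :* e :* y) in
          (:1 :- M) :* (:1 :- p :* M) :* (:- e :* a :* (:1 :+ z) :* (x :* y))
            :+ (U :* (z :* x₁) :+ V :* (z :* x₂))
          := (p :* (:- e :* a :* (:1 :+ z) :* (x₁ :* ((:1 :- z :* M) :* y)))
            :+ :- e :* a :* z :* (x₂ :* y)
            :- a :* e :* (x :* ((:1 :- z :* p) :* ((:1 :- z :* M) :* y))))
            :+ (U :* ((z :- M) :* x) :+ V :* ((z :- p) :* x₁)))
          refl z M p a e x x₁ x₂ y)
        (+-cong (*-congˡ {U} x₁-rel) (*-congˡ {V} x₂-rel))

  β : ℕ → Carrier
  β n = poch⁻¹ n * oddPoch⁻¹ n

  -- q^{n(n-1)/2}
  qC2 : ℕ → Carrier
  qC2 zero    = 1#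
  qC2 (suc n) = q ^ n * qC2 n

  bailey-0 : ∀ a R → bailey a 0 R ≈ 1#
  bailey-0 a R = begin
    1# * 1# + Σ (λ r → a (suc r) * (1# + q ^ dbl (suc r)) * T 0 (suc r)) R
      ≈⟨ +-cong (*-identityˡ 1#) (Σ-0 R (λ r → trans (*-congˡ (zeroˡ _)) (zeroʳ _))) ⟩
    1# + 0# ≈⟨ +-identityʳ 1# ⟩
    1# ∎

  solve-step : ∀ n {x y g} → (1# - q ^ suc n) * (1# - q ^ n * q ^ suc n) * x ≈ y + g → g ≈ 0# →
    x ≈ inv n * (inv (n ℕ.+ n) * y)
  solve-step n {x} {y} {g} e g≈0 = begin
    x
      ≈⟨ trans (*-congʳ (trans (*-cong (inv-law n) (inv-law (n ℕ.+ n))) (*-identityˡ 1#))) (*-identityˡ x) ⟨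
    (1# - M) * inv n * ((1# - q ^ suc (n ℕ.+ n)) * inv (n ℕ.+ n)) * x
      ≈⟨ *-congʳ (*-congˡ (*-congʳ (+-congˡ (-‿cong
           (trans (^-congʳ q (≡.sym (ℕ.+-suc n n))) (^-homo-* q n (suc n))))))) ⟩
    (1# - M) * inv n * ((1# - p * M) * inv (n ℕ.+ n)) * x
      ≈⟨ solve 5 (λ M p i j x → (:1 :- M) :* i :* ((:1 :- p :* M) :* j) :* x
            := i :* (j :* ((:1 :- M) :* (:1 :- p :* M) :* x))) refl M p (inv n) (inv (n ℕ.+ n)) x ⟩
    inv n * (inv (n ℕ.+ n) * ((1# - M) * (1# - p * M) * x))
      ≈⟨ *-congˡ (*-congˡ (trans e (trans (+-congˡ g≈0) (+-identityʳ y)))) ⟩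
    inv n * (inv (n ℕ.+ n) * y) ∎
    where
      M = q ^ suc n
      p = q ^ n

  -- The bound on n makes the boundary term vanish, since it contains 1/(q)_{n-2R-2} at the new n.
  -- What remains of the recurrence is the quotient of consecutive `β`.
  bailey₁ : ∀ R n → n ℕ.< dbl (suc R) → bailey a₁ n R ≈ β n
  bailey₁ R zero    _ = trans (bailey-0 a₁ R) (sym (*-identityˡ 1#))
  bailey₁ R (suc n) h = begin
    bailey a₁ (suc n) R
      ≈⟨ solve-step n (bailey₁-step n R) (trans (*-congˡ (trans (*-congʳ (poch⁻¹∸-< h)) (zeroˡ _))) (zeroʳ _)) ⟩
    inv n * (inv (n ℕ.+ n) * bailey a₁ n R)
      ≈⟨ *-congˡ (*-congˡ (bailey₁ R n (ℕ.<-trans (ℕ.n<1+n n) h))) ⟩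
    inv n * (inv (n ℕ.+ n) * (poch⁻¹ n * oddPoch⁻¹ n))
      ≈⟨ solve 4 (λ a b c d → a :* (b :* (c :* d)) := a :* c :* (b :* d)) refl (inv n) (inv (n ℕ.+ n)) (poch⁻¹ n) (oddPoch⁻¹ n) ⟩
    β (suc n) ∎

  bailey₅ : ∀ R n → n ℕ.< dbl (suc R) → bailey a₅ n R ≈ qC2 n * β n
  bailey₅ R zero    _ = trans (bailey-0 a₅ R) (sym (trans (*-identityˡ _) (*-identityˡ 1#)))
  bailey₅ R (suc n) h = begin
    bailey a₅ (suc n) R
      ≈⟨ solve-step n (bailey₅-step n R) (trans (*-congˡ (trans (*-congʳ (poch⁻¹∸-< h)) (zeroˡ _))) (zeroʳ _)) ⟩
    inv n * (inv (n ℕ.+ n) * (q ^ n * bailey a₅ n R))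
      ≈⟨ *-congˡ (*-congˡ (*-congˡ (bailey₅ R n (ℕ.<-trans (ℕ.n<1+n n) h)))) ⟩
    inv n * (inv (n ℕ.+ n) * (q ^ n * (qC2 n * (poch⁻¹ n * oddPoch⁻¹ n))))
      ≈⟨ solve 6 (λ a b c d p s → a :* (b :* (p :* (s :* (c :* d)))) := p :* s :* (a :* c :* (b :* d)))
            refl (inv n) (inv (n ℕ.+ n)) (poch⁻¹ n) (oddPoch⁻¹ n) (q ^ n) (qC2 n) ⟩
    qC2 (suc n) * β (suc n) ∎

  -- The difference of the two pairs, summed over n

  -- The difference of the two α_{2r+2}. The index starts there because the two α_0 cancel.
  δ : ℕ → Carrier
  δ r = (a₁ (suc r) - a₅ (suc r)) * (1# + q ^ dbl (suc r))

  bailey-difference : ∀ n R → bailey a₁ n R ≈ bailey a₅ n R + Σ (λ r → δ r * T n (suc r)) R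
  bailey-difference n zero    = sym (+-identityʳ _)
  bailey-difference n (suc R) = begin
    T n 0 + (S₁ + a₁ (suc R) * z * t)
      ≈⟨ +-assoc _ _ _ ⟨
    T n 0 + S₁ + a₁ (suc R) * z * t
      ≈⟨ +-congʳ (bailey-difference n R) ⟩
    T n 0 + S₅ + S + a₁ (suc R) * z * t
      ≈⟨ solve 7 (λ t₀ s₅ s a b z t → t₀ :+ s₅ :+ s :+ a :* z :* t
            := t₀ :+ (s₅ :+ b :* z :* t) :+ (s :+ (a :- b) :* z :* t)) refl
            (T n 0) S₅ S (a₁ (suc R)) (a₅ (suc R)) z t ⟩
    T n 0 + (S₅ + a₅ (suc R) * z * t) + (S + δ R * t) ∎
    where
      z = 1# + q ^ dbl (suc R)
      t = T n (suc R)
      S₁ = Σ (λ r → a₁ (suc r) * (1# + q ^ dbl (suc r)) * T n (suc r)) R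
      S₅ = Σ (λ r → a₅ (suc r) * (1# + q ^ dbl (suc r)) * T n (suc r)) R
      S  = Σ (λ r → δ r * T n (suc r)) R

  -- The contribution of `δ r` to the sum over 1 ≤ s ≤ n, in closed form: it vanishes at n = 0, and
  -- `term-step` gives its increments.
  term : ℕ → ℕ → Carrier
  term n r = δ r * (inv (suc (dbl r)) * inv (suc (dbl r))) * (q ^ dbl (suc r) * (poch n * poch n * T n (suc r)))

  -- (1 - q^n)² - (1 - q^{n-2r})(1 - q^{n+2r}) = q^{n-2r} (1 - q^{2r})², at n + 1 and r + 1.
  term-step : ∀ n r → term (suc n) r ≈ term n r + q ^ suc n * (poch n * poch n) * (δ r * T (suc n) (suc r))
  term-step n r = trans
    (cancel
      (solve 8 (λ z M P d j x x₁ y →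
        let U = d :* (j :* j) :* (P :* P) :* ((:1 :- z :* M) :* y)
            V = :- (d :* (P :* P) :* (x :* y) :* M) in
        d :* (j :* j) :* (z :* (((:1 :- M) :* P) :* ((:1 :- M) :* P) :* (x :* y)))
          :+ (U :* (z :* x₁) :+ V :* (((:1 :- z) :* j) :* ((:1 :- z) :* j)))
        := (d :* (j :* j) :* (z :* (P :* P :* (x₁ :* ((:1 :- z :* M) :* y))))
            :+ M :* (P :* P) :* (d :* (x :* y)))
          :+ (U :* ((z :- M) :* x) :+ V :* (:1 :* :1)))
        refl z M P (δ r) j x x₁ y)
      (+-cong (*-congˡ {U} x₁-rel) (*-congˡ {V} (*-cong (inv-law (suc (dbl r))) (inv-law (suc (dbl r)))))))
    (+-congʳ (*-congˡ (*-congˡ (*-congˡ (*-congˡ (sym y₁-rel))))))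
    where
      open Step n r
      P = poch n
      j = inv (suc (dbl r))
      U = δ r * (j * j) * (P * P) * ((1# - z * M) * y)
      V = - (δ r * (P * P) * (x * y) * M)

  partialSum : ℕ → Carrier
  partialSum = Σ (λ n → q ^ suc n * (poch n * poch n) * (β (suc n) - qC2 (suc n) * β (suc n)))

  -- An exchange of the sums over s and r, exact because both Bailey sums are complete for every s ≤
  -- n < 2R + 2.
  partialSum≈Σterm : ∀ R n → n ℕ.< dbl (suc R) → partialSum n ≈ Σ (term n) R
  partialSum≈Σterm R zero    _ = sym (Σ-0 R (λ r → trans (*-congˡ (trans (*-congˡ (trans (*-congˡ (zeroˡ _)) (zeroʳ _))) (zeroʳ _))) (zeroʳ _)))
  partialSum≈Σterm R (suc n) h = begin
    partialSum n + w * (β (suc n) - qC2 (suc n) * β (suc n))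
      ≈⟨ +-cong (sym (partialSum≈Σterm R n (ℕ.<-trans (ℕ.n<1+n n) h))) (*-congˡ (+-cong (bailey₁ R (suc n) h) (-‿cong (bailey₅ R (suc n) h)))) ⟨
    Σ (term n) R + w * (bailey a₁ (suc n) R - bailey a₅ (suc n) R)
      ≈⟨ +-congˡ (*-congˡ (+-congʳ (bailey-difference (suc n) R))) ⟩
    Σ (term n) R + w * (bailey a₅ (suc n) R + Σ (λ r → δ r * T (suc n) (suc r)) R - bailey a₅ (suc n) R)
      ≈⟨ +-congˡ (*-congˡ (xyx⁻¹≈y _ _)) ⟩
    Σ (term n) R + w * Σ (λ r → δ r * T (suc n) (suc r)) R
      ≈⟨ +-congˡ (Σ-*ˡ w _ R) ⟨
    Σ (term n) R + Σ (λ r → w * (δ r * T (suc n) (suc r))) R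
      ≈⟨ Σ-+ (term n) _ R ⟨
    Σ (λ r → term n r + w * (δ r * T (suc n) (suc r))) R
      ≈⟨ Σ-cong R (λ r _ → term-step n r) ⟨
    Σ (term (suc n)) R ∎
    where w = q ^ suc n * (poch n * poch n)

  -- Limits modulo powers of q

  poch-inverse : ∀ n → poch n * poch⁻¹ n ≈ 1#
  poch-inverse zero    = *-identityˡ 1#
  poch-inverse (suc n) = begin
    (1# - q ^ suc n) * poch n * (inv n * poch⁻¹ n)
      ≈⟨ solve 4 (λ a b c d → a :* b :* (c :* d) := (a :* c) :* (b :* d)) refl (1# - q ^ suc n) (poch n) (inv n) (poch⁻¹ n) ⟩
    ((1# - q ^ suc n) * inv n) * (poch n * poch⁻¹ n)
      ≈⟨ *-cong (inv-law n) (poch-inverse n) ⟩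
    1# * 1# ≈⟨ *-identityˡ 1# ⟩
    1# ∎

  inv-unfold : ∀ n → inv n ≈ 1# + q ^ suc n * inv n
  inv-unfold n = begin
    inv n
      ≈⟨ solve 2 (λ m i → i := (:1 :- m) :* i :+ m :* i) refl (q ^ suc n) (inv n) ⟩
    (1# - q ^ suc n) * inv n + q ^ suc n * inv n
      ≈⟨ +-congʳ (inv-law n) ⟩
    1# + q ^ suc n * inv n ∎

  infix 4 _≈1mod_
  _≈1mod_ : Carrier → ℕ → Set _
  f ≈1mod k = ∃[ h ] f ≈ 1# + q ^ k * h

  -- The factors left in (q)_{d+k}/(q)_k are 1 - q^i with i > k.
  poch-+-≈1 : ∀ d k → poch (d ℕ.+ k) * poch⁻¹ k ≈1mod suc k
  poch-+-≈1 zero    k = 0# , trans (poch-inverse k) (sym (trans (+-congˡ (zeroʳ _)) (+-identityʳ 1#)))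
  poch-+-≈1 (suc d) k with poch-+-≈1 d k
  ... | h , e = h - q ^ d - q ^ d * q ^ suc k * h , (begin
    (1# - q ^ suc (d ℕ.+ k)) * poch (d ℕ.+ k) * poch⁻¹ k
      ≈⟨ *-assoc _ _ _ ⟩
    (1# - q ^ suc (d ℕ.+ k)) * (poch (d ℕ.+ k) * poch⁻¹ k)
      ≈⟨ *-cong (+-congˡ (-‿cong (trans (^-congʳ q (≡.sym (ℕ.+-suc d k))) (^-homo-* q d (suc k))))) e ⟩
    (1# - q ^ d * q ^ suc k) * (1# + q ^ suc k * h)
      ≈⟨ solve 3 (λ d k h → (:1 :- d :* k) :* (:1 :+ k :* h) := :1 :+ k :* (h :- d :- d :* k :* h)) refl (q ^ d) (q ^ suc k) h ⟩
    1# + q ^ suc k * (h - q ^ d - q ^ d * q ^ suc k * h) ∎)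

  poch⁻¹-+-≈1 : ∀ d n → poch n * poch⁻¹ (d ℕ.+ n) ≈1mod suc n
  poch⁻¹-+-≈1 zero    n = poch-+-≈1 zero n
  poch⁻¹-+-≈1 (suc d) n with poch⁻¹-+-≈1 d n
  ... | h , e = q ^ d * i + h + q ^ d * i * (q ^ suc n * h) , (begin
    poch n * (i * poch⁻¹ (d ℕ.+ n))
      ≈⟨ solve 3 (λ a b c → a :* (b :* c) := b :* (a :* c)) refl (poch n) i (poch⁻¹ (d ℕ.+ n)) ⟩
    i * (poch n * poch⁻¹ (d ℕ.+ n))
      ≈⟨ *-cong (trans (inv-unfold (d ℕ.+ n)) (+-congˡ (*-congʳ (trans (^-congʳ q (≡.sym (ℕ.+-suc d n))) (^-homo-* q d (suc n)))))) e ⟩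
    (1# + q ^ d * q ^ suc n * i) * (1# + q ^ suc n * h)
      ≈⟨ solve 4 (λ d k i h → (:1 :+ d :* k :* i) :* (:1 :+ k :* h)
            := :1 :+ k :* (d :* i :+ h :+ d :* i :* (k :* h))) refl (q ^ d) (q ^ suc n) i h ⟩
    1# + q ^ suc n * (q ^ d * i + h + q ^ d * i * (q ^ suc n * h)) ∎)
    where i = inv (d ℕ.+ n)

  -- For d ≤ n the quotient of q-factorials is 1 modulo q^{n-d+1}, and the prefactor `q ^ d` raises
  -- the error to q^{n+1}. For d > n the left side is 0 and `q ^ d` is itself divisible by q^{n+1}.
  q^d-limit : ∀ d n → ∃[ h ]
    q ^ d * (poch n * poch n * (poch⁻¹∸ n d * poch⁻¹ (d ℕ.+ n))) ≈ q ^ d + q ^ suc n * h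
  q^d-limit d n with d ℕ.≤? n
  ... | no d≰n = - q ^ (d ℕ.∸ suc n) , (begin
    q ^ d * (poch n * poch n * (poch⁻¹∸ n d * poch⁻¹ (d ℕ.+ n)))
      ≈⟨ *-congˡ (trans (*-congˡ (trans (*-congʳ (poch⁻¹∸-< (ℕ.≰⇒> d≰n))) (zeroˡ _))) (zeroʳ _)) ⟩
    q ^ d * 0#
      ≈⟨ trans (zeroʳ _) (sym (-‿inverseʳ _)) ⟩
    q ^ d - q ^ d
      ≈⟨ +-congˡ (-‿cong (trans (^-congʳ q (≡.sym (ℕ.m+[n∸m]≡n (ℕ.≰⇒> d≰n)))) (^-homo-* q (suc n) (d ℕ.∸ suc n)))) ⟩
    q ^ d - q ^ suc n * q ^ (d ℕ.∸ suc n)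
      ≈⟨ +-congˡ (-‿distribʳ-* _ _) ⟩
    q ^ d + q ^ suc n * (- q ^ (d ℕ.∸ suc n)) ∎)
  ... | yes d≤n with ℕ.m≤n⇒∃[o]m+o≡n d≤n
  ... | k , ≡.refl with poch-+-≈1 d k | poch⁻¹-+-≈1 d (d ℕ.+ k)
  ... | h , e | h′ , e′ = h + q ^ d * h′ + q ^ suc n′ * h * h′ , (begin
    q ^ d * (poch n′ * poch n′ * (poch⁻¹∸ n′ d * poch⁻¹ (d ℕ.+ n′)))
      ≡⟨ ≡.cong (λ c → q ^ d * (poch n′ * poch n′ * (c * poch⁻¹ (d ℕ.+ n′)))) (poch⁻¹∸-+ d k) ⟩
    q ^ d * (poch n′ * poch n′ * (poch⁻¹ k * poch⁻¹ (d ℕ.+ n′)))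
      ≈⟨ solve 4 (λ d p c c′ → d :* (p :* p :* (c :* c′)) := d :* ((p :* c) :* (p :* c′))) refl
            (q ^ d) (poch n′) (poch⁻¹ k) (poch⁻¹ (d ℕ.+ n′)) ⟩
    q ^ d * ((poch n′ * poch⁻¹ k) * (poch n′ * poch⁻¹ (d ℕ.+ n′)))
      ≈⟨ *-congˡ (*-cong e e′) ⟩
    q ^ d * ((1# + q ^ suc k * h) * (1# + q ^ suc n′ * h′))
      ≈⟨ solve 5 (λ d s t h h′ → d :* ((:1 :+ s :* h) :* (:1 :+ t :* h′))
            := d :+ (d :* s) :* h :+ t :* (d :* h′) :+ (d :* s) :* (t :* h :* h′)) refl (q ^ d) (q ^ suc k) (q ^ suc n′) h h′ ⟩
    q ^ d + (q ^ d * q ^ suc k) * h + q ^ suc n′ * (q ^ d * h′) + (q ^ d * q ^ suc k) * (q ^ suc n′ * h * h′)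
      ≈⟨ +-cong (+-congʳ (+-congˡ (*-congʳ q^n))) (*-congʳ q^n) ⟩
    q ^ d + q ^ suc n′ * h + q ^ suc n′ * (q ^ d * h′) + q ^ suc n′ * (q ^ suc n′ * h * h′)
      ≈⟨ solve 4 (λ d t h h′ → d :+ t :* h :+ t :* (d :* h′) :+ t :* (t :* h :* h′)
            := d :+ t :* (h :+ d :* h′ :+ t :* h :* h′)) refl (q ^ d) (q ^ suc n′) h h′ ⟩
    q ^ d + q ^ suc n′ * (h + q ^ d * h′ + q ^ suc n′ * h * h′) ∎)
    where
      n′ = d ℕ.+ k
      q^n : q ^ d * q ^ suc k ≈ q ^ suc n′
      q^n = trans (sym (^-homo-* q d (suc k))) (^-congʳ q (ℕ.+-suc d k))

  -- What `Σ (term n) R` becomes modulo q^{n+1}. Only even powers of q and inverses of 1 - q^{2r+2}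
  -- enter.
  evenPart : ℕ → Carrier
  evenPart = Σ (λ r → δ r * (inv (suc (dbl r)) * inv (suc (dbl r))) * q ^ dbl (suc r))

  Σterm≈evenPart : ∀ n R → ∃[ h ] Σ (term n) R ≈ evenPart R + q ^ suc n * h
  Σterm≈evenPart n zero    = 0# , sym (trans (+-congˡ (zeroʳ _)) (+-identityʳ 0#))
  Σterm≈evenPart n (suc R) with Σterm≈evenPart n R | q^d-limit (dbl (suc R)) n
  ... | h , e | h′ , e′ = h + w * h′ , (begin
    Σ (term n) R + term n R
      ≈⟨ +-cong e (*-congˡ e′) ⟩
    (evenPart R + q ^ suc n * h) + w * (q ^ dbl (suc R) + q ^ suc n * h′)
      ≈⟨ solve 6 (λ s h c d t h′ → (s :+ t :* h) :+ c :* (d :+ t :* h′)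
            := (s :+ c :* d) :+ t :* (h :+ c :* h′)) refl (evenPart R) h w (q ^ dbl (suc R)) (q ^ suc n) h′ ⟩
    (evenPart R + w * q ^ dbl (suc R)) + q ^ suc n * (h + w * h′) ∎)
    where w = δ R * (inv (suc (dbl R)) * inv (suc (dbl R)))

  -- Closed form for a given smallest part

  evenPoch⁻¹ : ℕ → Carrier
  evenPoch⁻¹ zero    = 1#
  evenPoch⁻¹ (suc n) = inv (suc (dbl n)) * evenPoch⁻¹ n

  dbl≡+ : ∀ n → dbl n ≡ n ℕ.+ n
  dbl≡+ zero    = ≡.refl
  dbl≡+ (suc n) = ≡.cong suc (≡.trans (≡.cong suc (dbl≡+ n)) (≡.sym (ℕ.+-suc n n)))

  poch⁻¹-dbl : ∀ n → poch⁻¹ (dbl n) ≈ evenPoch⁻¹ n * oddPoch⁻¹ n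
  poch⁻¹-dbl zero    = sym (*-identityˡ 1#)
  poch⁻¹-dbl (suc n) = begin
    i * (inv (dbl n) * poch⁻¹ (dbl n))
      ≈⟨ *-congˡ (*-cong (reflexive (≡.cong inv (dbl≡+ n))) (poch⁻¹-dbl n)) ⟩
    i * (j * (evenPoch⁻¹ n * oddPoch⁻¹ n))
      ≈⟨ solve 4 (λ i j e o → i :* (j :* (e :* o)) := i :* e :* (j :* o)) refl i j (evenPoch⁻¹ n) (oddPoch⁻¹ n) ⟩
    i * evenPoch⁻¹ n * (j * oddPoch⁻¹ n) ∎
    where
      i = inv (suc (dbl n))
      j = inv (n ℕ.+ n)

  inv-poch : ∀ n → inv n ≈ poch n * poch⁻¹ (suc n)
  inv-poch n = sym (begin
    poch n * (inv n * poch⁻¹ n)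
      ≈⟨ solve 3 (λ a b c → a :* (b :* c) := b :* (a :* c)) refl (poch n) (inv n) (poch⁻¹ n) ⟩
    inv n * (poch n * poch⁻¹ n)
      ≈⟨ trans (*-congˡ (poch-inverse n)) (*-identityʳ _) ⟩
    inv n ∎)

  summand : ℕ → Carrier
  summand n = q ^ suc n * (poch n * poch n) * β (suc n)

  -- `G k` models the partitions with parts between s = n + 1 and k, counted by occurrences of s.
  -- The hypotheses say what admitting one more part size does: it is free up to 2s, and beyond that
  -- odd sizes are forbidden and even ones free. `G-smallest` is the sum of j q^{js} over j.
  module ClosedForm (n : ℕ) (G : ℕ → Carrier)
    (G-smallest : G (suc n) ≈ inv n * (q ^ suc n * inv n))
    (G-small : ∀ k → suc n ℕ.≤ k → k ℕ.< dbl (suc n) → G (suc k) ≈ inv k * G k)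
    (G-odd   : ∀ k → suc n ℕ.≤ k → G (suc (dbl k)) ≈ G (dbl k))
    (G-even  : ∀ k → suc n ℕ.≤ k → G (dbl (suc k)) ≈ inv (suc (dbl k)) * G (suc (dbl k)))
    where

    -- The free parts s+1, ..., s+d contribute (q)_s/(q)_{s+d}, whose factor 1 - q^s cancels one of
    -- the two in q^s/(1-q^s)².
    poch-G : ∀ d → d ℕ.≤ suc n → G (d ℕ.+ suc n) ≈ q ^ suc n * (poch n * inv n) * poch⁻¹ (d ℕ.+ suc n)
    poch-G zero    _ = begin
      G (suc n)
        ≈⟨ G-smallest ⟩
      inv n * (q ^ suc n * inv n)
        ≈⟨ *-congʳ (inv-poch n) ⟩
      poch n * poch⁻¹ (suc n) * (q ^ suc n * inv n)
        ≈⟨ solve 4 (λ a b c d → a :* b :* (c :* d) := c :* (a :* d) :* b) refl (poch n) (poch⁻¹ (suc n)) (q ^ suc n) (inv n) ⟩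
      q ^ suc n * (poch n * inv n) * poch⁻¹ (suc n) ∎
    poch-G (suc d) h = begin
      G (suc (d ℕ.+ suc n))
        ≈⟨ G-small (d ℕ.+ suc n) (ℕ.m≤n+m (suc n) d)
             (≡.subst (d ℕ.+ suc n ℕ.<_) (≡.sym (dbl≡+ (suc n))) (ℕ.+-monoˡ-≤ (suc n) h)) ⟩
      inv (d ℕ.+ suc n) * G (d ℕ.+ suc n)
        ≈⟨ *-congˡ (poch-G d (ℕ.<⇒≤ h)) ⟩
      inv (d ℕ.+ suc n) * (q ^ suc n * (poch n * inv n) * poch⁻¹ (d ℕ.+ suc n))
        ≈⟨ solve 3 (λ a b c → a :* (b :* c) := b :* (a :* c)) refl
             (inv (d ℕ.+ suc n)) (q ^ suc n * (poch n * inv n)) (poch⁻¹ (d ℕ.+ suc n)) ⟩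
      q ^ suc n * (poch n * inv n) * poch⁻¹ (suc d ℕ.+ suc n) ∎

    -- At 2s the denominator (q)_{2s} splits into even and odd factors, and later parts extend only
    -- the even one. Hence for a bound 2K the factor `evenPoch⁻¹ K` is the same for all s ≤ K and
    -- can be taken out of the sum over s.
    closedForm : ∀ e → G (dbl (e ℕ.+ suc n)) ≈ evenPoch⁻¹ (e ℕ.+ suc n) * summand n
    closedForm zero    = begin
      G (dbl (suc n))
        ≡⟨ ≡.cong G (dbl≡+ (suc n)) ⟩
      G (suc n ℕ.+ suc n)
        ≈⟨ poch-G (suc n) ℕ.≤-refl ⟩
      q ^ suc n * (poch n * inv n) * poch⁻¹ (suc n ℕ.+ suc n)
        ≡⟨ ≡.cong (λ k → q ^ suc n * (poch n * inv n) * poch⁻¹ k) (≡.sym (dbl≡+ (suc n))) ⟩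
      q ^ suc n * (poch n * inv n) * poch⁻¹ (dbl (suc n))
        ≈⟨ *-cong (*-congˡ (*-congˡ (inv-poch n))) (poch⁻¹-dbl (suc n)) ⟩
      q ^ suc n * (poch n * (poch n * poch⁻¹ (suc n))) * (evenPoch⁻¹ (suc n) * oddPoch⁻¹ (suc n))
        ≈⟨ solve 5 (λ z p c e o → z :* (p :* (p :* c)) :* (e :* o) := e :* (z :* (p :* p) :* (c :* o))) refl
             (q ^ suc n) (poch n) (poch⁻¹ (suc n)) (evenPoch⁻¹ (suc n)) (oddPoch⁻¹ (suc n)) ⟩
      evenPoch⁻¹ (suc n) * summand n ∎
    closedForm (suc e) = begin
      G (dbl (suc k))
        ≈⟨ trans (G-even k n<k) (*-congˡ (G-odd k n<k)) ⟩
      inv (suc (dbl k)) * G (dbl k)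
        ≈⟨ *-congˡ (closedForm e) ⟩
      inv (suc (dbl k)) * (evenPoch⁻¹ k * summand n)
        ≈⟨ *-assoc _ _ _ ⟨
      evenPoch⁻¹ (suc k) * summand n ∎
      where
        k = e ℕ.+ suc n
        n<k = ℕ.m≤n+m (suc n) e

  Σ-closedForms : ∀ (G : ℕ → Carrier) K →
    (∀ n → n ℕ.< K → G n ≈ evenPoch⁻¹ K * summand n) →
    ∃[ h ] Σ G K ≈ Σ (λ n → qC2 (suc n) * G n) K + evenPoch⁻¹ K * (evenPart K + q ^ suc K * h)
  -- Taking R = K satisfies K < 2R + 2, and n = K puts the error at q^{K+1}.
  Σ-closedForms G K hyp with Σterm≈evenPart K K
  ... | h , e = h , (begin
    Σ G K
      ≈⟨ Σ-cong K split ⟩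
    Σ (λ n → qC2 (suc n) * G n + P * (q ^ suc n * (poch n * poch n) * (β (suc n) - qC2 (suc n) * β (suc n)))) K
      ≈⟨ Σ-+ _ _ K ⟩
    Σ (λ n → qC2 (suc n) * G n) K + Σ (λ n → P * (q ^ suc n * (poch n * poch n) * (β (suc n) - qC2 (suc n) * β (suc n)))) K
      ≈⟨ +-congˡ (Σ-*ˡ P _ K) ⟩
    Σ (λ n → qC2 (suc n) * G n) K + P * partialSum K
      ≈⟨ +-congˡ (*-congˡ (trans (partialSum≈Σterm K K (n<dbl K)) e)) ⟩
    Σ (λ n → qC2 (suc n) * G n) K + P * (evenPart K + q ^ suc K * h) ∎)
    where
      P = evenPoch⁻¹ K
      n<dbl : ∀ n → n ℕ.< dbl (suc n)
      n<dbl zero    = s≤s z≤n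
      n<dbl (suc n) = s≤s (ℕ.m≤n⇒m≤1+n (n<dbl n))
      split : ∀ n → n ℕ.< K → G n ≈ qC2 (suc n) * G n
        + P * (q ^ suc n * (poch n * poch n) * (β (suc n) - qC2 (suc n) * β (suc n)))
      split n n<K = begin
        G n
          ≈⟨ solve 2 (λ g c → g := c :* g :+ (:1 :- c) :* g) refl (G n) (qC2 (suc n)) ⟩
        qC2 (suc n) * G n + (1# - qC2 (suc n)) * G n
          ≈⟨ +-congˡ (*-congˡ (hyp n n<K)) ⟩
        qC2 (suc n) * G n + (1# - qC2 (suc n)) * (P * summand n)
          ≈⟨ +-congˡ (solve 4 (λ c p w b → (:1 :- c) :* (p :* (w :* b)) := p :* (w :* (b :- c :* b))) refl
               (qC2 (suc n)) P (q ^ suc n * (poch n * poch n)) (β (suc n))) ⟩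
        qC2 (suc n) * G n + P * (q ^ suc n * (poch n * poch n) * (β (suc n) - qC2 (suc n) * β (suc n))) ∎

-- Formal power series over the integers

module PowerSeries where
  open import Data.Integer as ℤ using (ℤ; +_; 0ℤ; 1ℤ)
  import Data.Integer.Properties as ℤ
  open import Data.Integer.Solver using (module +-*-Solver)
  open +-*-Solver using (solve; _:=_; _:+_; _:*_)
  open ≡ using (refl; sym; trans; cong; cong₂)
  open ≡.≡-Reasoning

  Series : Set
  Series = ℕ → ℤ

  infix 4 _≋_
  -- A record, so that the two series can be inferred from the type of an equality proof.
  record _≋_ (f g : Series) : Set where
    constructor coeffs
    field at : ∀ n → f n ≡ g n
  open _≋_ public

  infixl 6 _⊕_
  infixl 7 _⊛_ _·_

  tail : Series → Series
  tail f n = f (suc n)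

  -- The Cauchy product as f(0) g + X (tail f) g, so that the ring laws follow by induction on the
  -- coefficient, without sums over antidiagonals.
  _⊕_ _⊛_ : Series → Series → Series
  (f ⊕ g) n = f n ℤ.+ g n
  (f ⊛ g) zero    = f 0 ℤ.* g 0
  (f ⊛ g) (suc n) = f 0 ℤ.* g (suc n) ℤ.+ (tail f ⊛ g) n

  _·_ : ℤ → Series → Series
  (k · f) n = k ℤ.* f n

  ⊖_ : Series → Series
  (⊖ f) n = ℤ.- f n

  𝟘 𝟙 X : Series
  𝟘 n = 0ℤ
  𝟙 zero    = 1ℤ
  𝟙 (suc n) = 0ℤ
  X zero    = 0ℤ
  X (suc n) = 𝟙 n

  ⊛-cong : ∀ {f f′ g g′} → (∀ n → f n ≡ f′ n) → (∀ n → g n ≡ g′ n) → ∀ n → (f ⊛ g) n ≡ (f′ ⊛ g′) n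
  ⊛-cong e e′ zero    = cong₂ ℤ._*_ (e 0) (e′ 0)
  ⊛-cong e e′ (suc n) = cong₂ ℤ._+_ (cong₂ ℤ._*_ (e 0) (e′ (suc n))) (⊛-cong (λ n → e (suc n)) e′ n)

  ⊛-distribʳ : ∀ h f g n → ((f ⊕ g) ⊛ h) n ≡ (f ⊛ h) n ℤ.+ (g ⊛ h) n
  ⊛-distribʳ h f g zero    = ℤ.*-distribʳ-+ (h 0) (f 0) (g 0)
  ⊛-distribʳ h f g (suc n) = trans (cong (λ x → (f 0 ℤ.+ g 0) ℤ.* h (suc n) ℤ.+ x) (⊛-distribʳ h (tail f) (tail g) n))
    (solve 5 (λ a b c d e → (a :+ b) :* c :+ (d :+ e) := (a :* c :+ d) :+ (b :* c :+ e)) refl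
      (f 0) (g 0) (h (suc n)) ((tail f ⊛ h) n) ((tail g ⊛ h) n))

  ·-⊛ : ∀ k f g n → ((k · f) ⊛ g) n ≡ k ℤ.* (f ⊛ g) n
  ·-⊛ k f g zero    = ℤ.*-assoc k (f 0) (g 0)
  ·-⊛ k f g (suc n) = trans (cong (λ x → k ℤ.* f 0 ℤ.* g (suc n) ℤ.+ x) (·-⊛ k (tail f) g n))
    (solve 4 (λ k a b c → k :* a :* b :+ k :* c := k :* (a :* b :+ c)) refl k (f 0) (g (suc n)) ((tail f ⊛ g) n))

  ⊛-assoc : ∀ f g h n → ((f ⊛ g) ⊛ h) n ≡ (f ⊛ (g ⊛ h)) n
  ⊛-assoc f g h zero    = ℤ.*-assoc (f 0) (g 0) (h 0)
  ⊛-assoc f g h (suc n) = begin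
    f 0 ℤ.* g 0 ℤ.* h (suc n) ℤ.+ (((f 0 · tail g) ⊕ (tail f ⊛ g)) ⊛ h) n
      ≡⟨ cong (λ x → f 0 ℤ.* g 0 ℤ.* h (suc n) ℤ.+ x)
           (trans (⊛-distribʳ h (f 0 · tail g) (tail f ⊛ g) n)
             (cong₂ ℤ._+_ (·-⊛ (f 0) (tail g) h n) (⊛-assoc (tail f) g h n))) ⟩
    f 0 ℤ.* g 0 ℤ.* h (suc n) ℤ.+ (f 0 ℤ.* (tail g ⊛ h) n ℤ.+ (tail f ⊛ (g ⊛ h)) n)
      ≡⟨ solve 5 (λ a b c d e → a :* b :* c :+ (a :* d :+ e) := a :* (b :* c :+ d) :+ e) refl
           (f 0) (g 0) (h (suc n)) ((tail g ⊛ h) n) ((tail f ⊛ (g ⊛ h)) n) ⟩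
    f 0 ℤ.* (g 0 ℤ.* h (suc n) ℤ.+ (tail g ⊛ h) n) ℤ.+ (tail f ⊛ (g ⊛ h)) n ∎

  -- The mirror image of the defining recursion, as commutativity requires.
  ⊛-suc : ∀ f g n → (f ⊛ g) (suc n) ≡ f (suc n) ℤ.* g 0 ℤ.+ (f ⊛ tail g) n
  ⊛-suc f g zero    = ℤ.+-comm (f 0 ℤ.* g 1) (f 1 ℤ.* g 0)
  ⊛-suc f g (suc n) = trans (cong (λ x → f 0 ℤ.* g (suc (suc n)) ℤ.+ x) (⊛-suc (tail f) g n))
    (solve 3 (λ a b c → a :+ (b :+ c) := b :+ (a :+ c)) refl
      (f 0 ℤ.* g (suc (suc n))) (f (suc (suc n)) ℤ.* g 0) ((tail f ⊛ tail g) n))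

  ⊛-comm : ∀ f g n → (f ⊛ g) n ≡ (g ⊛ f) n
  ⊛-comm f g zero    = ℤ.*-comm (f 0) (g 0)
  ⊛-comm f g (suc n) = trans (cong₂ ℤ._+_ (ℤ.*-comm (f 0) (g (suc n))) (⊛-comm (tail f) g n))
    (sym (⊛-suc g f n))

  ⊛-zeroˡ : ∀ g n → (𝟘 ⊛ g) n ≡ 0ℤ
  ⊛-zeroˡ g zero    = refl
  ⊛-zeroˡ g (suc n) = trans (ℤ.+-identityˡ _) (⊛-zeroˡ g n)

  ⊛-identityˡ : ∀ g n → (𝟙 ⊛ g) n ≡ g n
  ⊛-identityˡ g zero    = ℤ.*-identityˡ (g 0)
  ⊛-identityˡ g (suc n) = trans (cong₂ ℤ._+_ (ℤ.*-identityˡ (g (suc n))) (⊛-zeroˡ g n)) (ℤ.+-identityʳ _)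

  seriesRing : CommutativeRing 0ℓ 0ℓ
  seriesRing = record
    { Carrier = Series
    ; _≈_     = _≋_
    ; _+_     = _⊕_
    ; _*_     = _⊛_
    ; -_      = ⊖_
    ; 0#      = 𝟘
    ; 1#      = 𝟙
    ; isCommutativeRing = record
      { isRing = record
        { +-isAbelianGroup = record
          { isGroup = record
            { isMonoid = record
              { isSemigroup = record
                { isMagma = record
                  { isEquivalence = record
                    { refl  = coeffs λ n → refl
                    ; sym   = λ e → coeffs λ n → sym (at e n)
                    ; trans = λ e e′ → coeffs λ n → trans (at e n) (at e′ n)
                    }
                  ; ∙-cong = λ e e′ → coeffs λ n → cong₂ ℤ._+_ (at e n) (at e′ n)
                  }
                ; assoc = λ f g h → coeffs λ n → ℤ.+-assoc (f n) (g n) (h n)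
                }
              ; identity = (λ f → coeffs λ n → ℤ.+-identityˡ (f n))
                         , (λ f → coeffs λ n → ℤ.+-identityʳ (f n))
              }
            ; inverse = (λ f → coeffs λ n → ℤ.+-inverseˡ (f n))
                      , (λ f → coeffs λ n → ℤ.+-inverseʳ (f n))
            ; ⁻¹-cong = λ e → coeffs λ n → cong ℤ.-_ (at e n)
            }
          ; comm = λ f g → coeffs λ n → ℤ.+-comm (f n) (g n)
          }
        ; *-cong     = λ e e′ → coeffs (⊛-cong (at e) (at e′))
        ; *-assoc    = λ f g h → coeffs (⊛-assoc f g h)
        ; *-identity = (λ f → coeffs (⊛-identityˡ f))
                     , (λ f → coeffs λ n → trans (⊛-comm f 𝟙 n) (⊛-identityˡ f n))
        ; distrib    = (λ f g h → coeffs λ n → trans (⊛-comm f (g ⊕ h) n)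
                         (trans (⊛-distribʳ f g h n) (cong₂ ℤ._+_ (⊛-comm g f n) (⊛-comm h f n))))
                     , (λ f g h → coeffs (⊛-distribʳ f g h))
        }
      ; *-comm = λ f g → coeffs (⊛-comm f g)
      }
    }

  module R = CommutativeRing seriesRing
  open import Algebra.Properties.Semiring.Exp R.semiring using (_^_)

  X⊛-suc : ∀ f n → (X ⊛ f) (suc n) ≡ f n
  X⊛-suc f n = trans (ℤ.+-identityˡ _) (⊛-identityˡ f n)

  X^-≥ : ∀ k f n → (X ^ k ⊛ f) (k ℕ.+ n) ≡ f n
  X^-≥ zero    f n = ⊛-identityˡ f n
  X^-≥ (suc k) f n = trans (⊛-assoc X (X ^ k) f (suc k ℕ.+ n))
    (trans (X⊛-suc (X ^ k ⊛ f) (k ℕ.+ n)) (X^-≥ k f n))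

  X^-< : ∀ k f n → n ℕ.< k → (X ^ k ⊛ f) n ≡ 0ℤ
  X^-< (suc k) f zero    _         = ⊛-assoc X (X ^ k) f 0
  X^-< (suc k) f (suc n) (s≤s n<k) = trans (⊛-assoc X (X ^ k) f (suc n))
    (trans (X⊛-suc (X ^ k ⊛ f) n) (X^-< k f n n<k))

  -- shiftedGeometric k j = X^j / (1 - X^{k+1})
  shiftedGeometric : ℕ → ℕ → Series
  shiftedGeometric k zero    zero    = 1ℤ
  shiftedGeometric k zero    (suc n) = shiftedGeometric k k n
  shiftedGeometric k (suc j) zero    = 0ℤ
  shiftedGeometric k (suc j) (suc n) = shiftedGeometric k j n

  geometric : ℕ → Series
  geometric k = shiftedGeometric k 0

  shiftedGeometric≋ : ∀ k j → shiftedGeometric k j ≋ X ^ j ⊛ geometric k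
  shiftedGeometric≋ k zero    = R.sym (R.*-identityˡ (geometric k))
  shiftedGeometric≋ k (suc j) = R.trans
    (coeffs λ { zero → refl ; (suc n) → sym (X⊛-suc (shiftedGeometric k j) n) })
    (R.trans (R.*-congˡ {X} (shiftedGeometric≋ k j)) (R.sym (R.*-assoc X (X ^ j) (geometric k))))

  geometric-unfold : ∀ k → geometric k ≋ 𝟙 ⊕ X ^ suc k ⊛ geometric k
  geometric-unfold k = R.trans
    (coeffs λ { zero    → refl
              ; (suc n) → sym (trans (ℤ.+-identityˡ _) (X⊛-suc (shiftedGeometric k k) n)) })
    (R.+-congˡ {𝟙} (R.trans (R.*-congˡ {X} (shiftedGeometric≋ k k)) (R.sym (R.*-assoc X (X ^ k) (geometric k)))))

  open import Algebra.Properties.Ring R.ring using (xyx⁻¹≈y; [y-z]x≈yx-zx)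

  [1-X^]⊛ : ∀ k f g → f ≋ g ⊕ X ^ suc k ⊛ f → (𝟙 ⊕ ⊖ (X ^ suc k)) ⊛ f ≋ g
  [1-X^]⊛ k f g e = R.trans ([y-z]x≈yx-zx f 𝟙 (X ^ suc k))
    (R.trans (R.+-congʳ (R.trans (R.*-identityˡ f) (R.trans e (R.+-comm g (X ^ suc k ⊛ f)))))
      (xyx⁻¹≈y (X ^ suc k ⊛ f) g))

  geometric-inverse : ∀ k → (𝟙 ⊕ ⊖ (X ^ suc k)) ⊛ geometric k ≋ 𝟙
  geometric-inverse k = [1-X^]⊛ k (geometric k) 𝟙 (geometric-unfold k)

  geometric-solve : ∀ k f g → f ≋ g ⊕ X ^ suc k ⊛ f → f ≋ geometric k ⊛ g
  geometric-solve k f g e = R.sym (R.trans (R.*-congˡ {geometric k} (R.sym ([1-X^]⊛ k f g e)))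
    (R.trans (R.sym (R.*-assoc (geometric k) (𝟙 ⊕ ⊖ (X ^ suc k)) f))
      (R.trans (R.*-congʳ (R.trans (R.*-comm (geometric k) (𝟙 ⊕ ⊖ (X ^ suc k))) (geometric-inverse k))) (R.*-identityˡ f))))

  open BaileyPairs seriesRing X geometric geometric-inverse public

  -- Even and odd series

  parity : ℕ → Bool
  parity zero    = false
  parity (suc n) = not (parity n)

  record HasParity (b : Bool) (f : Series) : Set where
    constructor vanishing
    field vanish : ∀ n → parity n ≡ not b → f n ≡ 0ℤ
  open HasParity public

  Even : Series → Set
  Even = HasParity false

  -- Odd series must be included because the recursion of the product passes to `tail f`, which has
  -- the opposite parity.
  ⊛-parity : ∀ b f g → HasParity b f → Even g → ∀ n → parity n ≡ not b → (f ⊛ g) n ≡ 0ℤ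
  ⊛-parity true  f g p e zero    _ = cong (ℤ._* g 0) (vanish p 0 refl)
  ⊛-parity b     f g p e (suc n) q =
    cong₂ ℤ._+_ (head b p q)
      (⊛-parity (not b) (tail f) g
        (vanishing λ m r → vanish p (suc m) (trans (cong not r) (not-involutive (not b)))) e n
        (not-injective (trans q (sym (not-involutive (not b))))))
    where
      head : ∀ b → HasParity b f → not (parity n) ≡ not b → f 0 ℤ.* g (suc n) ≡ 0ℤ
      head true  p _ = cong (ℤ._* g (suc n)) (vanish p 0 refl)
      head false _ q = trans (cong (f 0 ℤ.*_) (vanish e (suc n) q)) (ℤ.*-zeroʳ (f 0))

  ⊛-even : ∀ {f g} → Even f → Even g → Even (f ⊛ g)
  ⊛-even {f} {g} e e′ = vanishing (⊛-parity false f g e e′)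

  ⊕-even : ∀ {f g} → Even f → Even g → Even (f ⊕ g)
  ⊕-even e e′ = vanishing λ n p → cong₂ ℤ._+_ (vanish e n p) (vanish e′ n p)

  ⊖-even : ∀ {f} → Even f → Even (⊖ f)
  ⊖-even e = vanishing λ n p → cong ℤ.-_ (vanish e n p)

  𝟘-even : Even 𝟘
  𝟘-even = vanishing λ _ _ → refl

  𝟙-even : Even 𝟙
  𝟙-even = vanishing λ { (suc n) _ → refl }

  X^dbl-vanish : ∀ r n → parity n ≡ true → (X ^ dbl r) n ≡ 0ℤ
  X^dbl-vanish zero    n             p = vanish 𝟙-even n p
  X^dbl-vanish (suc r) (suc zero)    p = X⊛-suc (X ⊛ X ^ dbl r) 0
  X^dbl-vanish (suc r) (suc (suc n)) p = trans (X⊛-suc (X ⊛ X ^ dbl r) (suc n))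
    (trans (X⊛-suc (X ^ dbl r) n) (X^dbl-vanish r n (trans (sym (not-involutive (parity n))) p)))

  X^dbl-even : ∀ r → Even (X ^ dbl r)
  X^dbl-even r = vanishing (X^dbl-vanish r)

  -- The exponents are j plus multiples of k + 1, which is even.
  shiftedGeometric-parity : ∀ k j → parity k ≡ true → ∀ n → parity n ≡ not (parity j) → shiftedGeometric k j n ≡ 0ℤ
  shiftedGeometric-parity k zero    o (suc n) p =
    shiftedGeometric-parity k k o n (trans (not-injective p) (cong not (sym o)))
  shiftedGeometric-parity k (suc j) o zero    p = refl
  shiftedGeometric-parity k (suc j) o (suc n) p = shiftedGeometric-parity k j o n (not-injective p)

  parity-dbl : ∀ n → parity (dbl n) ≡ false
  parity-dbl zero    = refl
  parity-dbl (suc n) = trans (not-involutive _) (parity-dbl n)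

  geometric-even : ∀ r → Even (geometric (suc (dbl r)))
  geometric-even r = vanishing (shiftedGeometric-parity (suc (dbl r)) 0 (cong not (parity-dbl r)))

  evenPoch⁻¹-even : ∀ n → Even (evenPoch⁻¹ n)
  evenPoch⁻¹-even zero    = 𝟙-even
  evenPoch⁻¹-even (suc n) = ⊛-even (geometric-even n) (evenPoch⁻¹-even n)

  a₁-even : ∀ r → Even (a₁ r)
  a₁-even zero    = 𝟙-even
  a₁-even (suc r) = ⊛-even (⊖-even (⊛-even (⊛-even (X^dbl-even r) (X^dbl-even r)) (X^dbl-even (suc r)))) (a₁-even r)

  a₅-even : ∀ r → Even (a₅ r)
  a₅-even zero    = 𝟙-even
  a₅-even (suc r) = ⊛-even (⊖-even (X^dbl-even r)) (a₅-even r)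

  evenPart-even : ∀ R → Even (evenPart R)
  evenPart-even zero    = 𝟘-even
  evenPart-even (suc R) = ⊕-even (evenPart-even R)
    (⊛-even (⊛-even (⊛-even (⊕-even (a₁-even (suc R)) (⊖-even (a₅-even (suc R))))
                            (⊕-even 𝟙-even (X^dbl-even (suc R))))
                    (⊛-even (geometric-even R) (geometric-even R)))
            (X^dbl-even (suc R)))

  -- The error begins one place beyond the coefficient that is read off.
  odd-coeff : ∀ K → parity K ≡ true → ∀ P f h → Even P → Even f → (P ⊛ (f ⊕ X ^ suc K ⊛ h)) K ≡ 0ℤ
  odd-coeff K odd P f h P-even f-even = trans (at (R.distribˡ P f (X ^ suc K ⊛ h)) K)
    (cong₂ ℤ._+_ (vanish (⊛-even P-even f-even) K odd)
      (trans (at (R.trans (R.sym (R.*-assoc P (X ^ suc K) h))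
                   (R.trans (R.*-congʳ {h} (R.*-comm P (X ^ suc K))) (R.*-assoc (X ^ suc K) P h))) K)
        (X^-< (suc K) (P ⊛ h) K ℕ.≤-refl)))

  Σ-odd-coeff : ∀ (G : ℕ → Series) K → parity K ≡ true →
    (∀ n → n ℕ.< K → G n ≋ evenPoch⁻¹ K ⊛ summand n) →
    Σ G K K ≡ Σ (λ n → qC2 (suc n) ⊛ G n) K K
  Σ-odd-coeff G K odd hyp = trans (at (proj₂ closed) K)
    (trans (cong (λ c → Σ (λ n → qC2 (suc n) ⊛ G n) K K ℤ.+ c)
             (odd-coeff K odd (evenPoch⁻¹ K) (evenPart K) (proj₁ closed) (evenPoch⁻¹-even K) (evenPart-even K)))
           (ℤ.+-identityʳ _))
    where closed = Σ-closedForms G K hyp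

-- Generating functions of weighted partitions

module PartitionSums where
  open PowerSeries
  open import Algebra.Properties.Semiring.Exp R.semiring using (_^_)
  open import Data.Integer as ℤ using (+_)
  import Data.Integer.Properties as ℤ
  open ≡ using (refl; sym; trans; cong; cong₂; subst)

  sumOver : (List ℕ → ℕ) → ℕ → ℕ → ℕ
  sumOver φ n k = sum (map φ (ptns n k))

  -- The multiplicities tried in `ptns`. The search range `N` is separate from `n` because removing
  -- one copy of the part shortens the two by different amounts.
  multiples : ℕ → ℕ → ℕ → List ℕ
  multiples p N n = filter (λ j → j ℕ.* p ≤? n) (upTo N)

  -- The clauses of `ptns` match on n first, so this computes only after a case split.
  ptns-suc : ∀ n k → ptns n (suc k) ≡
    concatMap (λ j → map (replicate j (suc k) ++_) (ptns (n ℕ.∸ j ℕ.* suc k) k)) (multiples (suc k) (suc n) n)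
  ptns-suc zero    k = refl
  ptns-suc (suc n) k = refl

  sum-map-concatMap : ∀ (φ : List ℕ → ℕ) (f : ℕ → List (List ℕ)) js →
    sum (map φ (concatMap f js)) ≡ sum (map (λ j → sum (map φ (f j))) js)
  sum-map-concatMap φ f []       = refl
  sum-map-concatMap φ f (j ∷ js) = trans (cong sum (map-++ φ (f j) (concatMap f js)))
    (trans (sum-++ (map φ (f j)) _) (cong (sum (map φ (f j)) ℕ.+_) (sum-map-concatMap φ f js)))

  sumOver-multiplicity : ∀ φ n k → sumOver φ n (suc k) ≡
    sum (map (λ j → sumOver (λ π → φ (replicate j (suc k) ++ π)) (n ℕ.∸ j ℕ.* suc k) k)
             (multiples (suc k) (suc n) n))
  sumOver-multiplicity φ n k = trans (cong (λ πs → sum (map φ πs)) (ptns-suc n k))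
    (trans (sum-map-concatMap φ (λ j → map (replicate j (suc k) ++_) (rest j)) (multiples (suc k) (suc n) n))
      (cong sum (map-cong (λ j → cong sum (sym (map-∘ {g = φ} {f = replicate j (suc k) ++_} (rest j))))
        (multiples (suc k) (suc n) n))))
    where rest = λ j → ptns (n ℕ.∸ j ℕ.* suc k) k

  multiples-< : ∀ p N n → n ℕ.< p → multiples p (suc N) n ≡ 0 ∷ []
  multiples-< p N n n<p = trans (filter-accept (λ j → j ℕ.* p ≤? n) {0} {applyUpTo suc N} z≤n)
    (cong (0 ∷_) (filter-none (λ j → j ℕ.* p ≤? n)
      (All.applyUpTo⁺₂ suc N (λ i → ℕ.<⇒≱ (ℕ.<-≤-trans n<p (ℕ.m≤m+n p (i ℕ.* p)))))))

  multiples-+ : ∀ d k n → multiples (suc k) (d ℕ.+ suc n) n ≡ multiples (suc k) (suc n) n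
  multiples-+ zero    k n = refl
  multiples-+ (suc d) k n =
    trans (cong (filter P?) (sym (upTo-∷ʳ N)))
      (trans (filter-++ P? (upTo N) (N ∷ []))
        (trans (cong (filter P? (upTo N) ++_) (filter-reject P? {N} {[]} (ℕ.<⇒≱ n<N*p)))
          (trans (++-identityʳ (filter P? (upTo N))) (multiples-+ d k n))))
    where
      N = d ℕ.+ suc n
      P? = λ j → j ℕ.* suc k ≤? n
      n<N*p : n ℕ.< N ℕ.* suc k
      n<N*p = ℕ.<-≤-trans (ℕ.m≤n+m (suc n) d) (ℕ.m≤m*n N (suc k))

  filter-multiples-suc : ∀ p m js →
    filter (λ j → j ℕ.* p ≤? p ℕ.+ m) (map suc js) ≡ map suc (filter (λ j → j ℕ.* p ≤? m) js)
  filter-multiples-suc p m []       = refl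
  filter-multiples-suc p m (j ∷ js) = by-cases (P? j)
    where
      P? = λ j → j ℕ.* p ≤? m
      Q? = λ j → j ℕ.* p ≤? p ℕ.+ m
      by-cases : Dec (j ℕ.* p ℕ.≤ m) → filter Q? (map suc (j ∷ js)) ≡ map suc (filter P? (j ∷ js))
      by-cases (yes h) = trans (filter-accept Q? {suc j} {map suc js} (ℕ.+-monoʳ-≤ p h))
        (trans (cong (suc j ∷_) (filter-multiples-suc p m js)) (cong (map suc) (sym (filter-accept P? {j} {js} h))))
      by-cases (no h)  = trans (filter-reject Q? {suc j} {map suc js} (λ h′ → h (ℕ.+-cancelˡ-≤ p _ _ h′)))
        (trans (filter-multiples-suc p m js) (cong (map suc) (sym (filter-reject P? {j} {js} h))))

  multiples-≥ : ∀ k m → multiples (suc k) (suc (suc k ℕ.+ m)) (suc k ℕ.+ m) ≡ 0 ∷ map suc (multiples (suc k) (suc m) m)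
  multiples-≥ k m = trans (filter-accept P? {0} {applyUpTo suc (suc k ℕ.+ m)} z≤n) (cong (0 ∷_)
    (trans (cong (filter P?) (sym (map-upTo suc (suc k ℕ.+ m))))
      (trans (filter-multiples-suc (suc k) m (upTo (suc k ℕ.+ m)))
        (cong (map suc) (trans (cong (λ N → multiples (suc k) N m) (sym (ℕ.+-suc k m))) (multiples-+ k k m))))))
    where P? = λ j → j ℕ.* suc k ≤? suc k ℕ.+ m

  sumOver-< : ∀ φ n k → n ℕ.< suc k → sumOver φ n (suc k) ≡ sumOver φ n k
  sumOver-< φ n k n<p = trans (sumOver-multiplicity φ n k)
    (trans (cong (λ js → sum (map F js)) (multiples-< (suc k) n n n<p)) (ℕ.+-identityʳ (F 0)))
    where F = λ j → sumOver (λ π → φ (replicate j (suc k) ++ π)) (n ℕ.∸ j ℕ.* suc k) k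

  -- Multiplicity 0 leaves parts at most k; otherwise one copy of `suc k` is removed and the bound
  -- stays. This trades the enumeration by multiplicity for a recurrence that yields a functional
  -- equation.
  sumOver-≥ : ∀ φ k m → sumOver φ (suc k ℕ.+ m) (suc k) ≡
    sumOver φ (suc k ℕ.+ m) k ℕ.+ sumOver (λ π → φ (suc k ∷ π)) m (suc k)
  sumOver-≥ φ k m = trans (sumOver-multiplicity φ n k)
    (trans (cong (λ js → sum (map F js)) (multiples-≥ k m))
      (cong (F 0 ℕ.+_) (trans (cong sum (trans (sym (map-∘ js)) (map-cong F-suc js)))
        (sym (sumOver-multiplicity (λ π → φ (suc k ∷ π)) m k)))))
    where
      n = suc k ℕ.+ m
      js = multiples (suc k) (suc m) m
      F = λ j → sumOver (λ π → φ (replicate j (suc k) ++ π)) (n ℕ.∸ j ℕ.* suc k) k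
      F-suc : ∀ j → F (suc j) ≡ sumOver (λ π → φ (suc k ∷ replicate j (suc k) ++ π)) (m ℕ.∸ j ℕ.* suc k) k
      F-suc j = cong (λ l → sumOver (λ π → φ (suc k ∷ replicate j (suc k) ++ π)) l k)
        (ℕ.[m+n]∸[m+o]≡n∸o (suc k) m (j ℕ.* suc k))

  sumOver-stable : ∀ φ n d → sumOver φ n (d ℕ.+ n) ≡ sumOver φ n n
  sumOver-stable φ n zero    = refl
  sumOver-stable φ n (suc d) = trans (sumOver-< φ n (d ℕ.+ n) (s≤s (ℕ.m≤n+m n d))) (sumOver-stable φ n d)

  series : (List ℕ → ℕ) → ℕ → Series
  series φ k n = + sumOver φ n k

  series-suc : ∀ φ k → series φ (suc k) ≋ series φ k ⊕ X ^ suc k ⊛ series (λ π → φ (suc k ∷ π)) (suc k)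
  series-suc φ k = coeffs go
    where
      ψ = series (λ π → φ (suc k ∷ π)) (suc k)
      go : ∀ n → series φ (suc k) n ≡ series φ k n ℤ.+ (X ^ suc k ⊛ ψ) n
      go n with suc k ≤? n
      ... | no p≰n  = trans (cong +_ (sumOver-< φ n k (ℕ.≰⇒> p≰n)))
        (sym (trans (cong (λ c → series φ k n ℤ.+ c) (X^-< (suc k) ψ n (ℕ.≰⇒> p≰n))) (ℤ.+-identityʳ _)))
      ... | yes p≤n with ℕ.m≤n⇒∃[o]m+o≡n p≤n
      ... | m , refl = trans (cong +_ (sumOver-≥ φ k m))
        (trans (ℤ.pos-+ (sumOver φ (suc k ℕ.+ m) k) (sumOver (λ π → φ (suc k ∷ π)) m (suc k)))
          (cong (λ c → series φ k (suc k ℕ.+ m) ℤ.+ c) (sym (X^-≥ (suc k) ψ m))))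

  series-cong : ∀ {φ ψ} k → (∀ π → φ π ≡ ψ π) → series φ k ≋ series ψ k
  series-cong k h = coeffs λ n → cong (λ l → + sum l) (map-cong h (ptns n k))

  sum-map-0 : ∀ (xs : List (List ℕ)) → sum (map (λ _ → 0) xs) ≡ 0
  sum-map-0 []       = refl
  sum-map-0 (x ∷ xs) = sum-map-0 xs

  sum-map-+ : ∀ (φ ψ : List ℕ → ℕ) xs → sum (map (λ π → φ π ℕ.+ ψ π) xs) ≡ sum (map φ xs) ℕ.+ sum (map ψ xs)
  sum-map-+ φ ψ []       = refl
  sum-map-+ φ ψ (x ∷ xs) = trans (cong ((φ x ℕ.+ ψ x) ℕ.+_) (sum-map-+ φ ψ xs))
    (interchange (φ x) (ψ x) (sum (map φ xs)) (sum (map ψ xs)))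
    where open import Algebra.Properties.CommutativeSemigroup ℕ.+-commutativeSemigroup using (interchange)

  series-+ : ∀ φ ψ k → series (λ π → φ π ℕ.+ ψ π) k ≋ series φ k ⊕ series ψ k
  series-+ φ ψ k = coeffs λ n → trans (cong +_ (sum-map-+ φ ψ (ptns n k))) (ℤ.pos-+ _ (sum (map ψ (ptns n k))))

  series-skip : ∀ φ k → (∀ π → φ (suc k ∷ π) ≡ 0) → series φ (suc k) ≋ series φ k
  series-skip φ k h = R.trans (series-suc φ k) (R.trans
    (R.+-congˡ {series φ k} (R.trans
      (R.*-congˡ {X ^ suc k} (R.trans (series-cong (suc k) h) (coeffs λ n → cong +_ (sum-map-0 (ptns n (suc k))))))
      (R.zeroʳ (X ^ suc k))))
    (R.+-identityʳ (series φ k)))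

  series-free : ∀ φ k → (∀ π → φ (suc k ∷ π) ≡ φ π) → series φ (suc k) ≋ geometric k ⊛ series φ k
  series-free φ k h = geometric-solve k (series φ (suc k)) (series φ k)
    (R.trans (series-suc φ k) (R.+-congˡ {series φ k} (R.*-congˡ {X ^ suc k} (series-cong (suc k) h))))

  -- Partitions with prescribed smallest part

  admits : ℕ → ℕ → Bool
  admits s p = not (isOdd p) ∨ (p ≤ᵇ 2 ℕ.* s)

  allowed : ℕ → ℕ → Bool
  allowed s p = (s ≤ᵇ p) ∧ admits s p

  count : ℕ → List ℕ → ℕ
  count s π = length (filter (λ p → p ≟ s) π)

  -- If s is not the smallest part then weight s π = 0: either a part is not allowed or the
  -- count vanishes.
  indicator weight : ℕ → List ℕ → ℕ
  indicator s π = if all (allowed s) π then 1 else 0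
  weight s π    = if all (allowed s) π then count s π else 0

  indicator-skip : ∀ s p π → allowed s p ≡ false → indicator s (p ∷ π) ≡ 0
  indicator-skip s p π h rewrite h = refl

  weight-skip : ∀ s p π → allowed s p ≡ false → weight s (p ∷ π) ≡ 0
  weight-skip s p π h rewrite h = refl

  indicator-free : ∀ s p π → allowed s p ≡ true → indicator s (p ∷ π) ≡ indicator s π
  indicator-free s p π h rewrite h = refl

  weight-free : ∀ s p π → allowed s p ≡ true → p ≢ s → weight s (p ∷ π) ≡ weight s π
  weight-free s p π h p≢s rewrite h =
    cong (λ l → if all (allowed s) π then length l else 0) (filter-reject (λ p → p ≟ s) {p} {π} p≢s)

  -- One more copy of s raises the count by 1 on every allowed partition, whence the `indicator`.
  weight-smallest : ∀ s π → allowed s s ≡ true → weight s (s ∷ π) ≡ indicator s π ℕ.+ weight s π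
  weight-smallest s π h rewrite h =
    trans (cong (λ l → if all (allowed s) π then length l else 0) (filter-accept (λ p → p ≟ s) {s} {π} refl))
      (if-suc (all (allowed s) π))
    where
      if-suc : ∀ b → (if b then suc (count s π) else 0) ≡ (if b then 1 else 0) ℕ.+ (if b then count s π else 0)
      if-suc true  = refl
      if-suc false = refl

  allowed-< : ∀ s p → p ℕ.< s → allowed s p ≡ false
  allowed-< s p p<s = cong (_∧ admits s p) (dec-false (s ≤? p) (ℕ.<⇒≱ p<s))

  allowed-admits : ∀ s p → s ℕ.≤ p → allowed s p ≡ admits s p
  allowed-admits s p s≤p = cong (_∧ admits s p) (dec-true (s ≤? p) s≤p)

  allowed-small : ∀ s p → s ℕ.≤ p → p ℕ.≤ 2 ℕ.* s → allowed s p ≡ true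
  allowed-small s p s≤p p≤2s = trans (allowed-admits s p s≤p)
    (trans (cong (not (isOdd p) ∨_) (dec-true (p ≤? 2 ℕ.* s) p≤2s)) (∨-zeroʳ (not (isOdd p))))

  dbl≡2* : ∀ n → dbl n ≡ 2 ℕ.* n
  dbl≡2* n = trans (dbl≡+ n) (cong (n ℕ.+_) (sym (ℕ.+-identityʳ n)))

  isOdd-dbl : ∀ k → isOdd (dbl k) ≡ false
  isOdd-dbl zero    = refl
  isOdd-dbl (suc k) = isOdd-dbl k

  isOdd-suc-dbl : ∀ k → isOdd (suc (dbl k)) ≡ true
  isOdd-suc-dbl zero    = refl
  isOdd-suc-dbl (suc k) = isOdd-suc-dbl k

  n≤dbl : ∀ n → n ℕ.≤ dbl n
  n≤dbl n = subst (n ℕ.≤_) (sym (dbl≡+ n)) (ℕ.m≤m+n n n)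

  allowed-even : ∀ s k → s ℕ.≤ k → allowed s (dbl k) ≡ true
  allowed-even s k s≤k = trans (allowed-admits s (dbl k) (ℕ.≤-trans s≤k (n≤dbl k)))
    (cong (λ b → not b ∨ (dbl k ≤ᵇ 2 ℕ.* s)) (isOdd-dbl k))

  allowed-odd : ∀ s k → s ℕ.≤ k → allowed s (suc (dbl k)) ≡ false
  allowed-odd s k s≤k = trans (allowed-admits s (suc (dbl k)) (ℕ.m≤n⇒m≤1+n (ℕ.≤-trans s≤k (n≤dbl k))))
    (cong₂ (λ b c → not b ∨ c) (isOdd-suc-dbl k) (dec-false (suc (dbl k) ≤? 2 ℕ.* s)
      (ℕ.<⇒≱ (s≤s (subst (2 ℕ.* s ℕ.≤_) (sym (dbl≡2* k)) (ℕ.*-monoʳ-≤ 2 s≤k))))))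

  series-indicator : ∀ s k → k ℕ.< s → series (indicator s) k ≋ 𝟙
  series-indicator s zero    _   = coeffs λ { zero → refl ; (suc n) → refl }
  series-indicator s (suc k) k<s = R.trans
    (series-skip (indicator s) k (λ π → indicator-skip s (suc k) π (allowed-< s (suc k) k<s)))
    (series-indicator s k (ℕ.<⇒≤ k<s))

  series-weight-< : ∀ s k → k ℕ.< s → series (weight s) k ≋ 𝟘
  series-weight-< s zero    _   = coeffs λ { zero → refl ; (suc n) → refl }
  series-weight-< s (suc k) k<s = R.trans
    (series-skip (weight s) k (λ π → weight-skip s (suc k) π (allowed-< s (suc k) k<s)))
    (series-weight-< s k (ℕ.<⇒≤ k<s))

  -- With I = 1/(1-X^s) for the indicator, the series W solves W = X^s (I + W); this is where the
  -- square of 1 - X^s arises.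
  series-weight-smallest : ∀ n → series (weight (suc n)) (suc n) ≋ geometric n ⊛ (X ^ suc n ⊛ geometric n)
  series-weight-smallest n = geometric-solve n (series (weight s) s) (X ^ s ⊛ geometric n)
    (R.trans (series-suc (weight s) n) (R.trans
      (R.+-cong (series-weight-< s n ℕ.≤-refl) (R.*-congˡ {X ^ s} (R.trans
        (series-cong s (λ π → weight-smallest s π s-allowed))
        (R.trans (series-+ (indicator s) (weight s) s) (R.+-congʳ {series (weight s) s} indicator-s)))))
      (R.trans (R.+-identityˡ (X ^ s ⊛ (geometric n ⊕ series (weight s) s)))
        (R.distribˡ (X ^ s) (geometric n) (series (weight s) s)))))
    where
      s = suc n
      s-allowed : allowed s s ≡ true
      s-allowed = allowed-small s s ℕ.≤-refl (ℕ.m≤m+n s (s ℕ.+ 0))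
      indicator-s : series (indicator s) s ≋ geometric n
      indicator-s = R.trans (series-free (indicator s) n (λ π → indicator-free s s π s-allowed))
        (R.trans (R.*-congˡ {geometric n} (series-indicator s n ℕ.≤-refl)) (R.*-identityʳ (geometric n)))

  series-weight : ∀ K n → n ℕ.< K → series (weight (suc n)) (dbl K) ≋ evenPoch⁻¹ K ⊛ summand n
  series-weight K n n<K = subst (λ K → series (weight s) (dbl K) ≋ evenPoch⁻¹ K ⊛ summand n)
    (ℕ.m∸n+n≡m n<K)
    (ClosedForm.closedForm n (series (weight s)) (series-weight-smallest n)
      (λ k s≤k k<2s → series-free (weight s) k (λ π → weight-free s (suc k) π
        (allowed-small s (suc k) (ℕ.m≤n⇒m≤1+n s≤k) (subst (suc k ℕ.≤_) (dbl≡2* s) k<2s)) (ℕ.>⇒≢ (s≤s s≤k))))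
      (λ k s≤k → series-skip (weight s) (dbl k) (λ π → weight-skip s (suc (dbl k)) π (allowed-odd s k s≤k)))
      (λ k s≤k → series-free (weight s) (suc (dbl k)) (λ π → weight-free s (dbl (suc k)) π
        (allowed-even s (suc k) (ℕ.m≤n⇒m≤1+n s≤k))
        (ℕ.>⇒≢ (ℕ.m≤n⇒m≤1+n (s≤s (ℕ.≤-trans s≤k (n≤dbl k)))))))
      (K ℕ.∸ suc n))
    where s = suc n

-- Sorting the spt sums by smallest part

module SptSums where
  open PowerSeries
  open PartitionSums
  open import Algebra.Properties.Semiring.Exp R.semiring using (_^_; ^-homo-*; ^-congʳ)
  open import Data.Integer as ℤ using (+_)
  import Data.Integer.Properties as ℤ
  open ≡ using (refl; sym; trans; cong; cong₂; subst)

  sum< : (ℕ → ℕ) → ℕ → ℕ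
  sum< f zero    = 0
  sum< f (suc n) = sum< f n ℕ.+ f n

  sum<-cong : ∀ {f g} N → (∀ n → n ℕ.< N → f n ≡ g n) → sum< f N ≡ sum< g N
  sum<-cong zero    h = refl
  sum<-cong (suc N) h = cong₂ ℕ._+_ (sum<-cong N (λ n n<N → h n (ℕ.m<n⇒m<1+n n<N))) (h N ℕ.≤-refl)

  sum<-0 : ∀ f N → (∀ n → n ℕ.< N → f n ≡ 0) → sum< f N ≡ 0
  sum<-0 f zero    h = refl
  sum<-0 f (suc N) h = cong₂ ℕ._+_ (sum<-0 f N (λ n n<N → h n (ℕ.m<n⇒m<1+n n<N))) (h N ℕ.≤-refl)

  sum<-pick : ∀ f N n → n ℕ.< N → (∀ i → i ≢ n → f i ≡ 0) → sum< f N ≡ f n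
  sum<-pick f (suc N) n n<1+N h with n ≟ N
  ... | yes refl = cong (ℕ._+ f n) (sum<-0 f n (λ i i<n → h i (ℕ.<⇒≢ i<n)))
  ... | no n≢N   = trans
    (cong₂ ℕ._+_ (sum<-pick f N n (ℕ.≤∧≢⇒< (ℕ.≤-pred n<1+N) n≢N) h) (h N (λ e → n≢N (sym e))))
    (ℕ.+-identityʳ (f n))

  sum<-+ : ∀ f g N → sum< (λ n → f n ℕ.+ g n) N ≡ sum< f N ℕ.+ sum< g N
  sum<-+ f g zero    = refl
  sum<-+ f g (suc N) = trans (cong (ℕ._+ (f N ℕ.+ g N)) (sum<-+ f g N))
    (interchange (sum< f N) (sum< g N) (f N) (g N))
    where open import Algebra.Properties.CommutativeSemigroup ℕ.+-commutativeSemigroup using (interchange)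

  sum<-swap : ∀ (f : ℕ → ℕ → ℕ) M N → sum< (λ k → sum< (f k) N) M ≡ sum< (λ n → sum< (λ k → f k n) M) N
  sum<-swap f zero    N = sym (sum<-0 (λ _ → 0) N (λ _ _ → refl))
  sum<-swap f (suc M) N = trans (cong (ℕ._+ sum< (f M) N) (sum<-swap f M N))
    (sym (sum<-+ (λ n → sum< (λ k → f k n) M) (f M) N))

  sum-upTo : ∀ (f : ℕ → ℕ) N → sum (map f (upTo N)) ≡ sum< f N
  sum-upTo f zero    = refl
  sum-upTo f (suc N) = trans (cong (λ js → sum (map f js)) (sym (upTo-∷ʳ N)))
    (trans (cong sum (map-++ f (upTo N) (N ∷ [])))
      (trans (sum-++ (map f (upTo N)) (f N ∷ [])) (cong₂ ℕ._+_ (sum-upTo f N) (ℕ.+-identityʳ (f N)))))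

  sum-map-sum< : ∀ (f : ℕ → List ℕ → ℕ) N πs →
    sum (map (λ π → sum< (λ n → f n π) N) πs) ≡ sum< (λ n → sum (map (f n) πs)) N
  sum-map-sum< f N []       = sym (sum<-0 (λ _ → 0) N (λ _ _ → refl))
  sum-map-sum< f N (π ∷ πs) = trans (cong (sum< (λ n → f n π) N ℕ.+_) (sum-map-sum< f N πs))
    (sym (sum<-+ (λ n → f n π) (λ n → sum (map (f n) πs)) N))

  sum-map-if : ∀ b (f : List ℕ → ℕ) πs →
    sum (map (λ π → if b then f π else 0) πs) ≡ (if b then sum (map f πs) else 0)
  sum-map-if true  f πs = refl
  sum-map-if false f πs = sum-map-0 πs

  smallest-≤ : ∀ x xs → foldr _⊓_ x xs ℕ.≤ x × All (foldr _⊓_ x xs ℕ.≤_) xs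
  smallest-≤ x []       = ℕ.≤-refl , []
  smallest-≤ x (y ∷ ys) with smallest-≤ x ys
  ... | ≤x , ≤ys = ℕ.≤-trans ⊓≤ ≤x , ℕ.m⊓n≤m y (foldr _⊓_ x ys) ∷ All.map (ℕ.≤-trans ⊓≤) ≤ys
    where ⊓≤ = ℕ.m⊓n≤n y (foldr _⊓_ x ys)

  smallest-∈ : ∀ x xs → foldr _⊓_ x xs ∈ x ∷ xs
  smallest-∈ x []       = here refl
  smallest-∈ x (y ∷ ys) with ℕ.⊓-sel y (foldr _⊓_ x ys) | smallest-∈ x ys
  ... | inj₁ e | _        = there (here e)
  ... | inj₂ e | here e′  = here (trans e e′)
  ... | inj₂ e | there i  = there (there (subst (_∈ ys) (sym e) i))

  all-false : ∀ (f : ℕ → Bool) {p π} → p ∈ π → f p ≡ false → all f π ≡ false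
  all-false f (here refl) h rewrite h = refl
  all-false f {π = x ∷ π} (there i) h = trans (cong (f x ∧_) (all-false f i h)) (∧-zeroʳ (f x))

  all-cong : ∀ (f g : ℕ → Bool) {π} → All (λ p → f p ≡ g p) π → all f π ≡ all g π
  all-cong f g []       = refl
  all-cong f g (e ∷ es) = cong₂ _∧_ e (all-cong f g es)

  weight-0 : ∀ s π → count s π ≡ 0 → weight s π ≡ 0
  weight-0 s π e with all (allowed s) π
  ... | true  = e
  ... | false = refl

  weight-< : ∀ s t π → s ℕ.< t → All (t ℕ.≤_) π → weight s π ≡ 0
  weight-< s t π s<t t≤π = weight-0 s π
    (cong length (filter-none (λ p → p ≟ s) (All.map (λ t≤p → ℕ.>⇒≢ (ℕ.<-≤-trans s<t t≤p)) t≤π)))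

  weight-> : ∀ s t π → t ℕ.< s → t ∈ π → weight s π ≡ 0
  weight-> s t π t<s t∈π = cong (λ b → if b then count s π else 0)
    (all-false (allowed s) t∈π (allowed-< s t t<s))

  if-0 : ∀ b {x} → x ≡ 0 → (if b then x else 0) ≡ 0
  if-0 true  e = e
  if-0 false e = refl

  -- Only n + 1 = `smallest π` contributes: a smaller value does not occur in π, and for a larger
  -- one the smallest part is not allowed. The predicate `b` carries the size condition of
  -- `sptoMinus` and is constantly true for `sptoPlus`.
  weight-by-smallest : ∀ (b : ℕ → Bool) M π → All (λ p → 1 ℕ.≤ p × p ℕ.≤ M) π →
    (if admissible π ∧ b (smallest π) then occ π else 0) ≡
    sum< (λ n → if b (suc n) then weight (suc n) π else 0) M
  weight-by-smallest b M []        _  = sym (sum<-0 _ M (λ n _ → if-0 (b (suc n)) refl))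
  weight-by-smallest b M π@(x ∷ xs) hs = at-smallest (smallest π) refl (All.lookup hs (smallest-∈ x xs))
    where
      s≤π : All (smallest π ℕ.≤_) π
      s≤π = proj₁ (smallest-≤ x xs) ∷ proj₂ (smallest-≤ x xs)

      if-∧ : ∀ a c (k : ℕ) → (if a ∧ c then k else 0) ≡ (if c then (if a then k else 0) else 0)
      if-∧ true  true  k = refl
      if-∧ true  false k = refl
      if-∧ false true  k = refl
      if-∧ false false k = refl

      at-smallest : ∀ s → s ≡ smallest π → 1 ℕ.≤ s × s ℕ.≤ M →
        (if all (admits s) π ∧ b s then count s π else 0) ≡
        sum< (λ n → if b (suc n) then weight (suc n) π else 0) M
      at-smallest zero    _ (() , _)
      at-smallest (suc m) e (_ , m<M) = trans
        (trans (if-∧ (all (admits (suc m)) π) (b (suc m)) (count (suc m) π))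
          (cong (λ a → if b (suc m) then (if a then count (suc m) π else 0) else 0)
            (all-cong (admits (suc m)) (allowed (suc m))
              (All.map (λ {p} s≤p → sym (allowed-admits (suc m) p (subst (ℕ._≤ p) (sym e) s≤p))) s≤π))))
        (sym (sum<-pick _ M m m<M others))
        where
          others : ∀ n → n ≢ m → (if b (suc n) then weight (suc n) π else 0) ≡ 0
          others n n≢m with ℕ.<-cmp n m
          ... | tri< n<m _ _ = if-0 (b (suc n))
            (weight-< (suc n) (suc m) π (s≤s n<m) (subst (λ s → All (s ℕ.≤_) π) (sym e) s≤π))
          ... | tri≈ _ n≡m _ = contradiction n≡m n≢m
          ... | tri> _ _ m<n = if-0 (b (suc n))
            (weight-> (suc n) (suc m) π (s≤s m<n) (subst (_∈ π) (sym e) (smallest-∈ x xs)))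

  ptns-bounded : ∀ n k → All (All (λ p → 1 ℕ.≤ p × p ℕ.≤ k)) (ptns n k)
  ptns-bounded zero    zero    = [] ∷ []
  ptns-bounded (suc n) zero    = []
  ptns-bounded n       (suc k) = subst (All _) (sym (ptns-suc n k))
    (All.concat⁺ (All.map⁺ (All.universal (λ j → All.map⁺ (All.map
      (λ hs → All.++⁺ (All.replicate⁺ j (s≤s z≤n , ℕ.≤-refl))
                (All.map (λ (l , u) → l , ℕ.m≤n⇒m≤1+n u) hs))
      (ptns-bounded (n ℕ.∸ j ℕ.* suc k) k))) (multiples (suc k) (suc n) n))))

  -- All sizes k ≤ m get the common part bound `dbl m`, harmless because parts never exceed k. They
  -- thus become coefficients of one series, the one with a closed form.
  sum-admissible : ∀ (b : ℕ → Bool) k m → k ℕ.≤ m →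
    sum (map (λ π → if admissible π ∧ b (smallest π) then occ π else 0) (partitions k)) ≡
    sum< (λ n → if b (suc n) then sumOver (weight (suc n)) k (dbl m) else 0) m
  sum-admissible b k m k≤m = trans
    (cong sum (map-cong-local (All.map
      (λ {π} hs → weight-by-smallest b m π (All.map (λ (l , u) → l , ℕ.≤-trans u k≤m) hs))
      (ptns-bounded k k))))
    (trans (sum-map-sum< (λ n π → if b (suc n) then weight (suc n) π else 0) m (partitions k))
      (sum<-cong m (λ n _ → trans (sum-map-if (b (suc n)) (weight (suc n)) (partitions k))
        (cong (λ c → if b (suc n) then c else 0) (stable n)))))
    where
      k≤2m : k ℕ.≤ dbl m
      k≤2m = ℕ.≤-trans k≤m (n≤dbl m)
      stable : ∀ n → sumOver (weight (suc n)) k k ≡ sumOver (weight (suc n)) k (dbl m)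
      stable n = trans (sym (sumOver-stable (weight (suc n)) k (dbl m ℕ.∸ k)))
        (cong (sumOver (weight (suc n)) k) (ℕ.m∸n+n≡m k≤2m))

  sum<-at : ∀ (f : ℕ → ℕ) (G : ℕ → Series) m M → (∀ n → + f n ≡ G n m) → + sum< f M ≡ Σ G M m
  sum<-at f G m zero    h = refl
  sum<-at f G m (suc M) h = trans (ℤ.pos-+ (sum< f M) (f M)) (cong₂ ℤ._+_ (sum<-at f G m M h) (h M))

  sptoPlus-series : ∀ m → + sptoPlus m ≡ Σ (λ n → series (weight (suc n)) (dbl m)) m m
  sptoPlus-series m = trans
    (cong (λ c → + sum c) (map-cong
      (λ π → cong (λ a → if a then occ π else 0) (sym (∧-identityʳ (admissible π)))) (partitions m)))
    (trans (cong +_ (sum-admissible (λ _ → true) m m ℕ.≤-refl))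
      (sum<-at _ (λ n → series (weight (suc n)) (dbl m)) m m (λ _ → refl)))

  qC2≋X^ : ∀ n → qC2 n ≋ X ^ (n C 2)
  qC2≋X^ zero    = R.refl
  qC2≋X^ (suc n) = R.trans (R.*-congˡ {X ^ n} (qC2≋X^ n))
    (R.trans (R.sym (^-homo-* X n (n C 2)))
      (^-congʳ X (trans (cong (ℕ._+ n C 2) (sym (nC1≡n n))) (nCk+nC[k+1]≡[n+1]C[k+1] n 1))))

  X^-coeff : ∀ c (a : ℕ → ℕ) m →
    + sum< (λ k → if k ℕ.+ c ≡ᵇ m then a k else 0) (suc m) ≡ (X ^ c ⊛ (λ k → + a k)) m
  X^-coeff c a m with c ≤? m
  ... | no c≰m = trans
    (cong +_ (sum<-0 _ (suc m) (λ k _ → cong (λ b → if b then a k else 0) (dec-false (k ℕ.+ c ≟ m)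
      (λ e → c≰m (subst (c ℕ.≤_) e (ℕ.m≤n+m c k)))))))
    (sym (X^-< c _ m (ℕ.≰⇒> c≰m)))
  ... | yes c≤m with ℕ.m≤n⇒∃[o]m+o≡n c≤m
  ... | l , refl = trans
    (cong +_ (trans
      (sum<-pick _ (suc (c ℕ.+ l)) l (s≤s (ℕ.m≤n+m l c))
        (λ k k≢l → cong (λ b → if b then a k else 0) (dec-false (k ℕ.+ c ≟ c ℕ.+ l)
          (λ e → k≢l (ℕ.+-cancelˡ-≡ c k l (trans (ℕ.+-comm c k) e))))))
      (cong (λ b → if b then a l else 0) (dec-true (l ℕ.+ c ≟ c ℕ.+ l) (ℕ.+-comm l c)))))
    (sym (X^-≥ c _ l))

  sptoMinus-series : ∀ m → + sptoMinus m ≡ Σ (λ n → qC2 (suc n) ⊛ series (weight (suc n)) (dbl m)) m m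
  sptoMinus-series m = trans
    (cong +_ (trans (sum-upTo _ (suc m)) (trans
      (sum<-cong (suc m) (λ k k<1+m → sum-admissible (λ s → k ℕ.+ (s C 2) ≡ᵇ m) k m (ℕ.≤-pred k<1+m)))
      (sum<-swap (λ k n → if k ℕ.+ (suc n C 2) ≡ᵇ m then sumOver (weight (suc n)) k (dbl m) else 0) (suc m) m))))
    (sum<-at _ (λ n → qC2 (suc n) ⊛ series (weight (suc n)) (dbl m)) m m (λ n → trans
      (X^-coeff (suc n C 2) (λ k → sumOver (weight (suc n)) k (dbl m)) m)
      (sym (at (R.*-congʳ {series (weight (suc n)) (dbl m)} (qC2≋X^ (suc n))) m))))

  odd-parity : ∀ n → parity (2 ℕ.* n ℕ.+ 1) ≡ true
  odd-parity n = subst (λ m → parity m ≡ true)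
    (trans (cong suc (dbl≡2* n)) (sym (ℕ.+-comm (2 ℕ.* n) 1))) (cong not (parity-dbl n))

open import Data.Nat using (_+_; _*_)

theorem5 : (n : ℕ) → sptoMinus (2 * n + 1) ≡ sptoPlus (2 * n + 1)
theorem5 n = ℤ.+-injective (begin
  ℤ.+ sptoMinus m
    ≡⟨ sptoMinus-series m ⟩
  Σ (λ k → qC2 (suc k) ⊛ series (weight (suc k)) (dbl m)) m m
    -- The truncation order is m itself: no smallest part exceeds m, and the error starts at
    -- X^{m+1}. The oddness of m enters here.
    ≡⟨ Σ-odd-coeff (λ k → series (weight (suc k)) (dbl m)) m (odd-parity n) (series-weight m) ⟨
  Σ (λ k → series (weight (suc k)) (dbl m)) m m
    ≡⟨ sptoPlus-series m ⟨
  ℤ.+ sptoPlus m ∎)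
  where
    open PowerSeries
    open PartitionSums
    open SptSums
    open ≡.≡-Reasoning
    import Data.Integer as ℤ
    import Data.Integer.Properties as ℤ
    m = 2 * n + 1
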